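{- Let $p$ be an odd prime and $\mathcal O$ a complete discrete valuation ring with maximal ideal generated by $p$ and perfect residue field, with unique Frobenius lift $\phi$. Let $d_1,d_2\in\mathcal O^\times$, $q_1=d_1\cdot1_2$, $q_2=d_2\cdot1_2$, and let $(\phi_1^{G'},\phi_2^{G'})$ be the Frobenius lifts attached to the Levi-Civita connection on $G'=GL_1^c=\mathrm{Spec}\,\mathcal O[\alpha,\beta,(\alpha^2+\beta^2)^{ -1}]$ over $\mathcal O$ attached to $(q_1,q_2)$. Put $$\epsilon=\phi\left(\frac{d_2}{d_1}\right)\in\mathcal O^\times,\qquad \theta_i=\frac{d_i^p(\alpha^2+\beta^2)^p}{\phi(d_i)(\alpha^{2p}+\beta^{2p})}\in\mathcal O(\widehat{G'})^\times,\ i=1,2,$$ let $(v_1,v_2)$ be the unique solution in $p\mathcal O(\widehat{G'})\times p\mathcal O(\widehat{G'})$ of the system $$x_1^2-2\epsilon x_2+\epsilon^2x_2^2=\theta_1-1,\qquad x_1^2+2\epsilon x_1+\epsilon^2x_2^2=\epsilon^2(\theta_2-1)$$ in the unknowns $x_1,x_2$, and let $u_2:=1+\epsilon^{ -1}v_1$, $u_1:=1-\epsilon v_2$. Then we have the following equality of matrices with coefficients in $\mathcal O(\widehat{G'})$: $$\phi_i^{G'}\begin{pmatrix}\alpha&\beta\\-\beta&\alpha\end{pmatrix}=\begin{pmatrix}\alpha^p&\beta^p\\-\beta^p&\alpha^p\end{pmatrix}\cdot\begin{pmatrix}u_i&v_i\\-v_i&u_i\end{pmatrix},\qquad i=1,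2.$$
   Context: For a matrix $a=(a_{ij})$, $a^t$ is the transpose and $a^{(p)}=(a_{ij}^p)$; set maps between rings are applied to matrices entrywise. A Frobenius lift on a ring $A$ is a ring endomorphism reducing mod $p$ to the $p$-power Frobenius of $A/pA$. On a $p$-torsion free ring a $p$-derivation $\delta$ is the same as a Frobenius lift $\phi$, via $\phi(a)=a^p+p\,\delta a$ ("attached"). $\widehat{\ }$ is $p$-adic completion. Let $x$ be a $2\times2$ matrix of indeterminates, $G=GL_2=\mathrm{Spec}\,\mathcal O[x,\det(x)^{ -1}]$, $\mathcal O(\widehat G)=\mathcal O[x,\det(x)^{ -1}]^{\widehat{\ }}$. A $p$-adic connection on $G$ is a $p$-derivation $\delta^G$ on $\mathcal O(\widehat G)$ extending that of $\mathcal O$, with attached Frobenius lift $\phi^G$. It is metric with respect to a symmetric $q\in GL_2(\mathcal O)$ if $\phi^G\circ\mathcal H_q=\mathcal H_q\circ\phi_0^G$, where $\mathcal H_q$ is the (continuous) $\mathcal O$-algebra endomorphism of $\mathcal O(\widehat G)$ with $x\mapsto x^tqx$ and $\phi_0^G$ is the Frobenius lift extending $\phi$ with $\phi_0^G(x)=x^{(p)}$. The Levi-Civita connection on $G$ attached to $(q_1,q_2)$ is the unique (it exists) pair $(\delta_1^G,\delta_2^G)$ of $p$-adic connections with $\delta_i^G$ metric with respect to $q_i$ and $\Gamma_{ijk}=\Gamma_{jik}$ for all $i,j,k\in\{1,2\}$, where $\Gamma_i=(\Gamma_{ijk})_{j,k}:=(\delta_i^Gx)^t\cdot\phi(q_i)\cdot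 x^{(p)}$. $G'=GL_1^c$ is embedded in $G$ via $x\mapsto\begin{pmatrix}\alpha&\beta\\-\beta&\alpha\end{pmatrix}$, and $\mathcal O(\widehat{G'})=\mathcal O[\alpha,\beta,(\alpha^2+\beta^2)^{ -1}]^{\widehat{\ }}$. When $q_1,q_2$ are scalar matrices, the ideal of $\mathcal O(\widehat G)$ defining $\widehat{G'}$ is sent into itself by $\delta_1^G,\delta_2^G$; the induced pair $(\delta_1^{G'},\delta_2^{G'})$ of $p$-derivations on $\mathcal O(\widehat{G'})$ is called the Levi-Civita connection on $G'$ attached to $(q_1,q_2)$. -}

module Defs where

open import Level using (_⊔_)
open import Algebra.Bundles using (CommutativeRing)
open import Algebra.Morphism.Bundles using (RingHomomorphism)
open import Algebra.Structures using (IsCommutativeRing)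
open import Algebra.Morphism.Structures using (module RingMorphisms)
import Algebra.Morphism.Construct.Composition as Composition
import Algebra.Definitions as Definitions
import Algebra.Properties.AbelianGroup as AbelianGroupProperties
import Algebra.Properties.Ring as RingProperties
import Algebra.Properties.Semiring.Exp as Exp
import Algebra.Properties.Semiring.Sum as Sum
import Algebra.Properties.CommutativeMonoid.Mult as CommutativeMonoidMult
import Algebra.Properties.Semiring.Mult as Mult
import Algebra.Properties.CommutativeSemiring.Exp as CommutativeExp
import Algebra.Properties.CommutativeSemiring.Binomial as Binomial
import Algebra.Properties.CommutativeSemigroup as CommutativeSemigroupProperties
open import Data.Empty using (⊥-elim)
open import Data.Fin.Base as Fin using (Fin; zero; suc; toℕ; fromℕ; inject₁)
import Data.Fin.Properties as Fin
open import Data.Fin.Patterns using (0F; 1F)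
open import Data.Nat.Base as ℕ using (ℕ; zero; suc; _!; _∸_; _<_)
open import Data.Nat.Combinatorics using (_C_; nCn≡1; k![n∸k]!∣n!)
open import Data.Nat.Combinatorics.Specification using (nCk≡n!/k![n-k]!)
open import Data.Nat.Divisibility using (_∣_; divides; ∣⇒≤; m∣m*n)
open import Data.Nat.DivMod using (m/n*n≡m)
open import Data.Nat.Primality using (Prime; euclidsLemma; prime⇒nonTrivial)
import Data.Nat.Properties as ℕ
open import Data.Product.Base using (∃; _,_; proj₁; proj₂)
open import Data.Sum.Base using (inj₁; inj₂)
open import Function.Base using (_∘_)
open import Function.Definitions using (Bijective)
open import Relation.Binary.PropositionalEquality.Core as ≡ using ()
open import Relation.Nullary.Negation.Core using (¬_)
import Relation.Binary.Reasoning.Setoid as SetoidReasoning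

infix 1 _⟶_

_⟶_ : ∀ {a ℓa b ℓb} → CommutativeRing a ℓa → CommutativeRing b ℓb → Set (a ⊔ ℓa ⊔ b ⊔ ℓb)
A ⟶ B = RingHomomorphism (CommutativeRing.rawRing A) (CommutativeRing.rawRing B)

open RingHomomorphism using (⟦_⟧)

module _ {a ℓa b ℓb} (A : CommutativeRing a ℓa) (B : CommutativeRing b ℓb) where
  private
    module A = CommutativeRing A
    module B = CommutativeRing B
    open AbelianGroupProperties B.+-abelianGroup using (identityˡ-unique; inverseʳ-unique)

  mkHom : (f : A.Carrier → B.Carrier) →
          (∀ {x y} → x A.≈ y → f x B.≈ f y) →
          (∀ x y → f (x A.+ y) B.≈ f x B.+ f y) →
          (∀ x y → f (x A.* y) B.≈ f x B.* f y) →
          f A.1# B.≈ B.1# →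
          A ⟶ B
  mkHom f cong +-homo *-homo 1-homo = record
    { ⟦_⟧ = f
    ; isRingHomomorphism = record
      { isSemiringHomomorphism = record
        { isNearSemiringHomomorphism = record
          { +-isMonoidHomomorphism = record
            { isMagmaHomomorphism = record
              { isRelHomomorphism = record { cong = cong }
              ; homo = +-homo
              }
            ; ε-homo = 0-homo
            }
          ; *-homo = *-homo
          }
        ; 1#-homo = 1-homo
        }
      ; -‿homo = λ x → inverseʳ-unique (f x) (f (A.- x))
          (B.trans (B.sym (+-homo x (A.- x))) (B.trans (cong (A.-‿inverseʳ x)) 0-homo))
      }
    }
    where
    0-homo : f A.0# B.≈ B.0#
    0-homo = identityˡ-unique (f A.0#) (f A.0#)
      (B.trans (B.sym (+-homo A.0# A.0#)) (cong (A.+-identityˡ A.0#)))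

module _ {a ℓa b ℓb c ℓc} (A : CommutativeRing a ℓa) (B : CommutativeRing b ℓb) (C : CommutativeRing c ℓc) where

  compose : B ⟶ C → A ⟶ B → A ⟶ C
  compose g f = record
    { isRingHomomorphism = Composition.isRingHomomorphism (CommutativeRing.trans C)
        (RingHomomorphism.isRingHomomorphism f) (RingHomomorphism.isRingHomomorphism g) }

record Congruent {c ℓ} (A : CommutativeRing c ℓ) (n : ℕ) (x y : CommutativeRing.Carrier A) : Set (c ⊔ ℓ) where
  constructor _,_
  open CommutativeRing A
  open Mult semiring using (_×_)
  field
    quotient : Carrier
    equation : x ≈ y + n × quotient

module CommutativeRingTheory {c ℓ} (A : CommutativeRing c ℓ) where
  open CommutativeRing A hiding (zero)
  open CommutativeExp commutativeSemiring public using (_^_)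
  open CommutativeExp commutativeSemiring using (^-congˡ; ^-distrib-*)
  open Mult semiring public using (_×_)
  open Mult semiring using (×-congʳ; ×-assocˡ; ×-assoc-*; ×-comm-*; ×-congˡ; ×-homo-1)
  open CommutativeMonoidMult +-commutativeMonoid using (×-distrib-+)
  open AbelianGroupProperties +-abelianGroup using (⁻¹-∙-comm; ε⁻¹≈ε; inverseʳ-unique)
  open CommutativeSemigroupProperties +-commutativeSemigroup using (interchange)
  open SetoidReasoning setoid

  infix 4 _≡_[mod_]

  _≡_[mod_] : Carrier → Carrier → ℕ → Set (c ⊔ ℓ)
  x ≡ y [mod n ] = Congruent A n x y

  IsUnit : Carrier → Set (c ⊔ ℓ)
  IsUnit = Definitions.Invertible _≈_ 1# _*_

  abstract
    ≈⇒mod : ∀ {n x y} → x ≈ y → x ≡ y [mod n ]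
    ≈⇒mod {n} {x} {y} x≈y = 0# , (begin
      x           ≈⟨ x≈y ⟩
      y           ≈⟨ +-identityʳ y ⟨
      y + 0#      ≈⟨ +-congˡ (×-zeroʳ n) ⟨
      y + n × 0#  ∎)
      where
      ×-zeroʳ : ∀ n → n × 0# ≈ 0#
      ×-zeroʳ zero    = refl
      ×-zeroʳ (suc n) = trans (+-identityˡ _) (×-zeroʳ n)

    ×-‿ : ∀ n x → n × (- x) ≈ - (n × x)
    ×-‿ zero    x = sym ε⁻¹≈ε
    ×-‿ (suc n) x = trans (+-congˡ (×-‿ n x)) (⁻¹-∙-comm x (n × x))

    mod-trans : ∀ {n x y z} → x ≡ y [mod n ] → y ≡ z [mod n ] → x ≡ z [mod n ]
    mod-trans {n} {x} {y} {z} (d , x≈) (e , y≈) = e + d , (begin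
      x                    ≈⟨ x≈ ⟩
      y + n × d            ≈⟨ +-congʳ y≈ ⟩
      (z + n × e) + n × d  ≈⟨ +-assoc _ _ _ ⟩
      z + (n × e + n × d)  ≈⟨ +-congˡ (×-distrib-+ e d n) ⟨
      z + n × (e + d)      ∎)

    mod-sym : ∀ {n x y} → x ≡ y [mod n ] → y ≡ x [mod n ]
    mod-sym {n} {x} {y} (d , x≈) = - d , (begin
      y                             ≈⟨ +-identityʳ y ⟨
      y + 0#                        ≈⟨ +-congˡ (-‿inverseʳ (n × d)) ⟨
      y + (n × d + - (n × d))       ≈⟨ +-assoc _ _ _ ⟨
      (y + n × d) + - (n × d)       ≈⟨ +-cong x≈ (×-‿ n d) ⟨
      x + n × (- d)                 ∎)

    mod-+ : ∀ {n x y u v} → x ≡ y [mod n ] → u ≡ v [mod n ] → x + u ≡ y + v [mod n ]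
    mod-+ {n} {x} {y} {u} {v} (d , x≈) (e , u≈) = d + e , (begin
      x + u                        ≈⟨ +-cong x≈ u≈ ⟩
      (y + n × d) + (v + n × e)    ≈⟨ interchange _ _ _ _ ⟩
      (y + v) + (n × d + n × e)    ≈⟨ +-congˡ (×-distrib-+ d e n) ⟨
      (y + v) + n × (d + e)        ∎)

    mod-*ʳ : ∀ {n x y} u → x ≡ y [mod n ] → x * u ≡ y * u [mod n ]
    mod-*ʳ {n} {x} {y} u (d , x≈) = d * u , (begin
      x * u                  ≈⟨ *-congʳ x≈ ⟩
      (y + n × d) * u        ≈⟨ distribʳ _ _ _ ⟩
      y * u + (n × d) * u    ≈⟨ +-congˡ (×-assoc-* n d u) ⟩
      y * u + n × (d * u)    ∎)

    mod-* : ∀ {n x y u v} → x ≡ y [mod n ] → u ≡ v [mod n ] → x * u ≡ y * v [mod n ]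
    mod-* {n} {x} {y} {u} {v} x≡ u≡ = mod-trans (mod-*ʳ u x≡)
      (mod-trans (≈⇒mod (*-comm y u)) (mod-trans (mod-*ʳ y u≡) (≈⇒mod (*-comm v y))))

    mod-‿ : ∀ {n x y} → x ≡ y [mod n ] → - x ≡ - y [mod n ]
    mod-‿ {n} {x} {y} (d , x≈) = - d , (begin
      - x                   ≈⟨ -‿cong x≈ ⟩
      - (y + n × d)         ≈⟨ ⁻¹-∙-comm y (n × d) ⟨
      - y + - (n × d)       ≈⟨ +-congˡ (×-‿ n d) ⟨
      - y + n × (- d)       ∎)

    mod-weaken : ∀ m {n x y} → x ≡ y [mod m ℕ.* n ] → x ≡ y [mod n ]
    mod-weaken m {n} {x} {y} (d , x≈) = m × d , (begin
      x                  ≈⟨ x≈ ⟩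
      y + (m ℕ.* n) × d  ≈⟨ +-congˡ (×-congˡ {d} (ℕ.*-comm m n)) ⟩
      y + (n ℕ.* m) × d  ≈⟨ +-congˡ (×-assocˡ d n m) ⟨
      y + n × (m × d)    ∎)

    multiple≡0 : ∀ {n k} → n ∣ k → ∀ x → k × x ≡ 0# [mod n ]
    multiple≡0 {n} {k} (divides q ≡.refl) x = mod-weaken q (x , sym (+-identityˡ _))

    multiple-* : ∀ {m n x y} → x ≡ 0# [mod m ] → y ≡ 0# [mod n ] → x * y ≡ 0# [mod m ℕ.* n ]
    multiple-* {m} {n} {x} {y} (d , x≈) (e , y≈) = d * e , (begin
      x * y                        ≈⟨ *-cong (trans x≈ (+-identityˡ _)) (trans y≈ (+-identityˡ _)) ⟩
      (m × d) * (n × e)            ≈⟨ ×-assoc-* m d (n × e) ⟩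
      m × (d * (n × e))            ≈⟨ ×-congʳ m (×-comm-* n d e) ⟩
      m × (n × (d * e))            ≈⟨ ×-assocˡ (d * e) m n ⟩
      (m ℕ.* n) × (d * e)          ≈⟨ +-identityˡ _ ⟨
      0# + (m ℕ.* n) × (d * e)     ∎)

    invert-* : ∀ {x y} → IsUnit x → IsUnit y → IsUnit (x * y)
    invert-* {x} {y} (x⁻¹ , _ , xx⁻¹) (y⁻¹ , _ , yy⁻¹) =
      x⁻¹ * y⁻¹ , trans (*-comm _ _) eq , eq
      where
      open CommutativeSemigroupProperties *-commutativeSemigroup using () renaming (interchange to *-interchange)
      eq : (x * y) * (x⁻¹ * y⁻¹) ≈ 1#
      eq = trans (*-interchange x y x⁻¹ y⁻¹) (trans (*-cong xx⁻¹ yy⁻¹) (*-identityˡ 1#))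

    invert-^ : ∀ {x} n → IsUnit x → IsUnit (x ^ n)
    invert-^ zero    _ = 1# , *-identityˡ 1# , *-identityˡ 1#
    invert-^ (suc n) u = invert-* u (invert-^ n u)

    invert-cong : ∀ {x y} → x ≈ y → IsUnit x → IsUnit y
    invert-cong x≈y (z , zx , xz) =
      z , trans (*-congˡ (sym x≈y)) zx , trans (*-congʳ (sym x≈y)) xz

  record Unit : Set (c ⊔ ℓ) where
    field
      value  : Carrier
      isUnit : IsUnit value

  open Unit public

  infixl 7 _*ᵘ_
  infix  8 _^ᵘ_

  _*ᵘ_ : Unit → Unit → Unit
  u *ᵘ v = record { value = value u * value v ; isUnit = invert-* (isUnit u) (isUnit v) }

  _^ᵘ_ : Unit → ℕ → Unit
  u ^ᵘ n = record { value = value u ^ n ; isUnit = invert-^ n (isUnit u) }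

  inverse : Unit → Unit
  inverse u = record
    { value  = proj₁ (isUnit u)
    ; isUnit = value u , proj₂ (proj₂ (isUnit u)) , proj₁ (proj₂ (isUnit u))
    }

module _ {a ℓa b ℓb} (A : CommutativeRing a ℓa) (B : CommutativeRing b ℓb) (f : A ⟶ B) where
  private
    module A = CommutativeRing A
    module B = CommutativeRing B
    module TA = CommutativeRingTheory A
    module TB = CommutativeRingTheory B
    module f = RingHomomorphism f

  abstract
    hom-× : ∀ n x → ⟦ f ⟧ (n TA.× x) B.≈ n TB.× ⟦ f ⟧ x
    hom-× zero    x = f.0#-homo
    hom-× (suc n) x = B.trans (f.+-homo x (n TA.× x)) (B.+-congˡ (hom-× n x))

    hom-mod : ∀ {n x y} → x TA.≡ y [mod n ] → ⟦ f ⟧ x TB.≡ ⟦ f ⟧ y [mod n ]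
    hom-mod {n} {x} {y} (d , x≈) = ⟦ f ⟧ d ,
      B.trans (f.⟦⟧-cong x≈) (B.trans (f.+-homo y (n TA.× d)) (B.+-congˡ (hom-× n d)))

    hom-IsUnit : ∀ {x} → TA.IsUnit x → TB.IsUnit (⟦ f ⟧ x)
    hom-IsUnit (x⁻¹ , l , r) = ⟦ f ⟧ x⁻¹ ,
      B.trans (B.sym (f.*-homo _ _)) (B.trans (f.⟦⟧-cong l) f.1#-homo) ,
      B.trans (B.sym (f.*-homo _ _)) (B.trans (f.⟦⟧-cong r) f.1#-homo)

  mapUnit : TA.Unit → TB.Unit
  mapUnit u = record { value = ⟦ f ⟧ (TA.value u) ; isUnit = hom-IsUnit (TA.isUnit u) }

p∤n! : ∀ {p} → Prime p → ∀ n → n < p → ¬ p ∣ n !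
p∤n! {p} pp zero    n<p p∣1 =
  ℕ.<⇒≱ (ℕ.nonTrivial⇒n>1 p {{prime⇒nonTrivial pp}}) (∣⇒≤ p∣1)
p∤n! {p} pp (suc n) n<p p∣ with euclidsLemma (suc n) (n !) pp p∣
... | inj₁ p∣1+n = ℕ.<⇒≱ n<p (∣⇒≤ p∣1+n)
... | inj₂ p∣n!  = p∤n! pp n (ℕ.<-trans (ℕ.n<1+n n) n<p) p∣n!

p∣pCk : ∀ {p} → Prime p → ∀ k → 0 < k → k < p → p ∣ p C k
p∣pCk {p@(suc m)} pp k 0<k k<p with euclidsLemma (p C k) (k ! ℕ.* (p ∸ k) !) pp p∣product
  where
  instance _ = ℕ._!*_!≢0 k (p ∸ k)
  product≡p! : (p C k) ℕ.* (k ! ℕ.* (p ∸ k) !) ≡.≡ p !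
  product≡p! = ≡.trans (≡.cong (ℕ._* (k ! ℕ.* (p ∸ k) !)) (nCk≡n!/k![n-k]! (ℕ.<⇒≤ k<p)))
                       (m/n*n≡m (k![n∸k]!∣n! (ℕ.<⇒≤ k<p)))
  p∣product : p ∣ (p C k) ℕ.* (k ! ℕ.* (p ∸ k) !)
  p∣product = ≡.subst (p ∣_) (≡.sym product≡p!) (m∣m*n (m !))
... | inj₁ p∣pCk = p∣pCk
... | inj₂ p∣k!*[p∸k]! with euclidsLemma (k !) ((p ∸ k) !) pp p∣k!*[p∸k]!
...   | inj₁ p∣k!     = ⊥-elim (p∤n! pp k k<p p∣k!)
...   | inj₂ p∣[p∸k]! = ⊥-elim (p∤n! pp (p ∸ k) (ℕ.∸-monoʳ-< 0<k (ℕ.<⇒≤ k<p)) p∣[p∸k]!)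

module _ {c ℓ} (A : CommutativeRing c ℓ) where
  open CommutativeRing A hiding (zero)
  open CommutativeRingTheory A
  open Sum semiring using (sum; sum-init-last)
  open Mult semiring using (×-homo-1; ×-cong)
  open Exp semiring using (^-congˡ; ^-congʳ)

  abstract
    sum≡0 : ∀ {p n} (t : Fin n → Carrier) → (∀ i → t i ≡ 0# [mod p ]) → sum t ≡ 0# [mod p ]
    sum≡0 {n = zero}  t t≡0 = ≈⇒mod refl
    sum≡0 {n = suc n} t t≡0 =
      mod-trans (mod-+ (t≡0 zero) (sum≡0 (t ∘ suc) (t≡0 ∘ suc))) (≈⇒mod (+-identityˡ 0#))

    frobenius-+ : ∀ {p} → Prime p → ∀ x y → (x + y) ^ p ≡ x ^ p + y ^ p [mod p ]
    frobenius-+ {p@(suc m)} pp x y =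
      mod-trans (≈⇒mod (trans (Binomial.theorem commutativeSemiring p x y)
                              (+-congˡ (sum-init-last (term ∘ suc)))))
      (mod-trans (mod-+ (≈⇒mod first) (mod-+ middle (≈⇒mod final)))
      (≈⇒mod (trans (+-congˡ (+-identityˡ _)) (+-comm _ _))))
      where
      term : Fin (suc p) → Carrier
      term = Binomial.binomialTerm commutativeSemiring x y p

      first : term zero ≈ y ^ p
      first = trans (×-homo-1 _) (*-identityˡ _)

      final : term (suc (fromℕ m)) ≈ x ^ p
      final = at-top (≡.cong suc (Fin.toℕ-fromℕ m))
        where
        at-top : ∀ {k} → k ≡.≡ p → (p C k) × (x ^ k * y ^ (p ∸ k)) ≈ x ^ p
        at-top ≡.refl = trans (×-cong (nCn≡1 p) (*-congˡ (^-congʳ y (ℕ.n∸n≡0 p))))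
                              (trans (×-homo-1 _) (*-identityʳ _))

      middle : sum (λ (i : Fin m) → term (suc (inject₁ i))) ≡ 0# [mod p ]
      middle = sum≡0 {n = m} (λ i → term (suc (inject₁ i))) λ i →
        multiple≡0 (p∣pCk pp (suc (toℕ (inject₁ i))) (ℕ.s≤s ℕ.z≤n)
          (ℕ.s≤s (≡.subst (_< m) (≡.sym (Fin.toℕ-inject₁ i)) (Fin.toℕ<n i)))) _

    0^p : ∀ {p} → Prime p → 0# ^ p ≈ 0#
    0^p {suc m} pp = zeroˡ _

    frobenius-‿ : ∀ {p} → Prime p → ∀ x → (- x) ^ p ≡ - (x ^ p) [mod p ]
    frobenius-‿ {p} pp x =
      mod-trans (≈⇒mod (sym (+-identityˡ _)))
      (mod-trans (mod-+ (≈⇒mod (sym (-‿inverseˡ (x ^ p)))) (≈⇒mod refl))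
      (mod-trans (≈⇒mod (+-assoc _ _ _))
      (mod-trans (mod-+ (≈⇒mod refl) (mod-sym (frobenius-+ pp x (- x))))
      (≈⇒mod (trans (+-congˡ (trans (^-congˡ p (-‿inverseʳ x)) (0^p pp))) (+-identityʳ _))))))

-- The p-adic completion is the limit of the rings A/pⁿA.  An element is a sequence of
-- representatives, the n-th one mattering only modulo pⁿ (so component 0 carries nothing).
record Limit {c ℓ} (p : ℕ) (A : CommutativeRing c ℓ) : Set (c ⊔ ℓ) where
  open CommutativeRing A using (Carrier)
  open CommutativeRingTheory A using (_≡_[mod_])
  field
    component : ℕ → Carrier
    coherent  : ∀ n → component (suc n) ≡ component n [mod p ℕ.^ n ]

open Limit public

record LimitEquality {c ℓ} (p : ℕ) (A : CommutativeRing c ℓ) (x y : Limit p A) : Set (c ⊔ ℓ) where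
  open CommutativeRingTheory A using (_≡_[mod_])
  field
    at : ∀ n → component x n ≡ component y n [mod p ℕ.^ n ]

open LimitEquality public

module _ {c ℓ} (p : ℕ) (A : CommutativeRing c ℓ) where
  private
    module A = CommutativeRing A
  open CommutativeRingTheory A

  pointwise : ∀ {x y} → (∀ n → component x n A.≈ component y n) → LimitEquality p A x y
  pointwise eq = record { at = λ n → ≈⇒mod (eq n) }

  _+̂_ _*̂_ : Limit p A → Limit p A → Limit p A
  x +̂ y = record
    { component = λ n → component x n A.+ component y n
    ; coherent  = λ n → mod-+ (coherent x n) (coherent y n) }
  x *̂ y = record
    { component = λ n → component x n A.* component y n
    ; coherent  = λ n → mod-* (coherent x n) (coherent y n) }

  -̂_ : Limit p A → Limit p A
  -̂ x = record
    { component = λ n → A.- component x n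
    ; coherent  = λ n → mod-‿ (coherent x n) }

  constant : A.Carrier → Limit p A
  constant x = record { component = λ _ → x ; coherent = λ _ → ≈⇒mod A.refl }

  abstract
    isCommutativeRing : IsCommutativeRing (LimitEquality p A) _+̂_ _*̂_ -̂_ (constant A.0#) (constant A.1#)
    isCommutativeRing = record
      { isRing = record
        { +-isAbelianGroup = record
          { isGroup = record
            { isMonoid = record
              { isSemigroup = record
                { isMagma = record
                  { isEquivalence = record
                    { refl  = pointwise λ n → A.refl
                    ; sym   = λ x≈y → record { at = λ n → mod-sym (at x≈y n) }
                    ; trans = λ x≈y y≈z → record { at = λ n → mod-trans (at x≈y n) (at y≈z n) }
                    }
                  ; ∙-cong = λ x≈y u≈v → record { at = λ n → mod-+ (at x≈y n) (at u≈v n) }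
                  }
                ; assoc = λ x y z → pointwise λ n → A.+-assoc _ _ _
                }
              ; identity = (λ x → pointwise λ n → A.+-identityˡ _) , (λ x → pointwise λ n → A.+-identityʳ _)
              }
            ; inverse = (λ x → pointwise λ n → A.-‿inverseˡ _) , (λ x → pointwise λ n → A.-‿inverseʳ _)
            ; ⁻¹-cong = λ x≈y → record { at = λ n → mod-‿ (at x≈y n) }
            }
          ; comm = λ x y → pointwise λ n → A.+-comm _ _
          }
        ; *-cong     = λ x≈y u≈v → record { at = λ n → mod-* (at x≈y n) (at u≈v n) }
        ; *-assoc    = λ x y z → pointwise λ n → A.*-assoc _ _ _
        ; *-identity = (λ x → pointwise λ n → A.*-identityˡ _) , (λ x → pointwise λ n → A.*-identityʳ _)
        ; distrib    = (λ x y z → pointwise λ n → A.distribˡ _ _ _) , (λ x y z → pointwise λ n → A.distribʳ _ _ _)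
        }
      ; *-comm = λ x y → pointwise λ n → A.*-comm _ _
      }

  completion : CommutativeRing (c ⊔ ℓ) (c ⊔ ℓ)
  completion = record { isCommutativeRing = isCommutativeRing }

  private
    module Â = CommutativeRing completion
    module T̂ = CommutativeRingTheory completion

  diagonal : A ⟶ completion
  diagonal = mkHom A completion
    constant
    (λ x≈y → record { at = λ n → ≈⇒mod x≈y })
    (λ x y → pointwise λ n → A.refl)
    (λ x y → pointwise λ n → A.refl)
    (pointwise λ n → A.refl)

  abstract
    component-× : ∀ k x n → component (k T̂.× x) n A.≈ k × component x n
    component-× zero    x n = A.refl
    component-× (suc k) x n = A.+-congˡ (component-× k x n)

    component-mod : ∀ {n x y} → x T̂.≡ y [mod p ℕ.^ n ] → component x n ≡ component y n [mod p ℕ.^ n ]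
    component-mod {n} {x} {y} (d , x≈) =
      mod-trans (at x≈ n)
      (mod-trans (mod-+ (≈⇒mod A.refl) (component d n , A.trans (component-× (p ℕ.^ n) d n) (A.sym (A.+-identityˡ _))))
                 (≈⇒mod (A.+-identityʳ _)))

  limit : (x : ℕ → Limit p A) → (∀ n → x (suc n) T̂.≡ x n [mod p ℕ.^ n ]) → Limit p A
  limit x cauchy = record
    { component = λ n → component (x n) n
    ; coherent  = λ n → mod-trans (coherent (x (suc n)) n) (component-mod (cauchy n))
    }

  abstract
    unit-mod-p : ∀ {x u} → T̂.IsUnit u → x T̂.≡ u [mod p ] → T̂.IsUnit x
    unit-mod-p {x} {u} (t , _ , ut≈1) x≡u = y , Â.trans (Â.*-comm y x) xy≈1 , xy≈1
      where
      open Â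
      open SetoidReasoning setoid

      e : Carrier
      e = 1# + - (x * t)

      e≡0 : e T̂.≡ 0# [mod p ]
      e≡0 = T̂.mod-trans (T̂.mod-+ (T̂.≈⇒mod refl) (T̂.mod-‿ (T̂.mod-trans (T̂.mod-*ʳ t x≡u) (T̂.≈⇒mod ut≈1))))
                        (T̂.≈⇒mod (-‿inverseʳ 1#))

      e^n≡0 : ∀ n → e T̂.^ n T̂.≡ 0# [mod p ℕ.^ n ]
      e^n≡0 zero    = 1# , trans (sym (+-identityʳ 1#)) (sym (+-identityˡ _))
      e^n≡0 (suc n) = T̂.multiple-* e≡0 (e^n≡0 n)

      approx : ℕ → Carrier
      approx zero    = 0#
      approx (suc n) = approx n + t * e T̂.^ n

      cauchy : ∀ n → approx (suc n) T̂.≡ approx n [mod p ℕ.^ n ]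
      cauchy n = T̂.mod-trans (T̂.mod-+ (T̂.≈⇒mod refl) (T̂.mod-* (T̂.≈⇒mod refl) (e^n≡0 n)))
                             (T̂.≈⇒mod (trans (+-congˡ (zeroʳ t)) (+-identityʳ _)))

      xt+e≈1 : x * t + e ≈ 1#
      xt+e≈1 = begin
        x * t + (1# + - (x * t))  ≈⟨ +-congˡ (+-comm _ _) ⟩
        x * t + (- (x * t) + 1#)  ≈⟨ +-assoc _ _ _ ⟨
        (x * t + - (x * t)) + 1#  ≈⟨ +-congʳ (-‿inverseʳ _) ⟩
        0# + 1#                   ≈⟨ +-identityˡ 1# ⟩
        1#                        ∎

      invariant : ∀ n → x * approx n + e T̂.^ n ≈ 1#
      invariant zero    = trans (+-congʳ (zeroʳ x)) (+-identityˡ 1#)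
      invariant (suc n) = begin
        x * (approx n + t * e T̂.^ n) + e * e T̂.^ n            ≈⟨ +-congʳ (distribˡ _ _ _) ⟩
        (x * approx n + x * (t * e T̂.^ n)) + e * e T̂.^ n      ≈⟨ +-assoc _ _ _ ⟩
        x * approx n + (x * (t * e T̂.^ n) + e * e T̂.^ n)      ≈⟨ +-congˡ (+-congʳ (*-assoc _ _ _)) ⟨
        x * approx n + (x * t * e T̂.^ n + e * e T̂.^ n)        ≈⟨ +-congˡ (distribʳ _ _ _) ⟨
        x * approx n + (x * t + e) * e T̂.^ n                  ≈⟨ +-congˡ (*-congʳ xt+e≈1) ⟩
        x * approx n + 1# * e T̂.^ n                           ≈⟨ +-congˡ (*-identityˡ _) ⟩
        x * approx n + e T̂.^ n                                ≈⟨ invariant n ⟩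
        1#                                                    ∎

      y : Carrier
      y = limit approx cauchy

      xy≈1 : x * y ≈ 1#
      xy≈1 = record { at = λ n → component-mod {n} {x * approx n} {1#}
        (T̂.mod-trans (T̂.mod-trans (T̂.≈⇒mod (sym (+-identityʳ _)))
                                   (T̂.mod-+ (T̂.≈⇒mod refl) (T̂.mod-sym (e^n≡0 n))))
                     (T̂.≈⇒mod (invariant n))) }

module _ {a ℓa b ℓb} (p : ℕ) (A : CommutativeRing a ℓa) (B : CommutativeRing b ℓb) where
  private
    module A = CommutativeRing A
    module B = CommutativeRing B
    module B̂ = CommutativeRing (completion p B)
    module TB = CommutativeRingTheory B

  -- The continuous extension of f: modulo pⁿ, its value at x is f applied to the n-th component of x.
  extend : (A ⟶ completion p B) → (completion p A ⟶ completion p B)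
  extend f = mkHom (completion p A) (completion p B)
    (λ x → limit p B (λ n → ⟦ f ⟧ (component x n)) (λ n → hom-mod A (completion p B) f (coherent x n)))
    (λ x≈y → record { at = λ n → component-mod p B (hom-mod A (completion p B) f (at x≈y n)) })
    (λ x y → record { at = λ n → at (f.+-homo (component x n) (component y n)) n })
    (λ x y → record { at = λ n → at (f.*-homo (component x n) (component y n)) n })
    (record { at = λ n → at f.1#-homo n })
    where module f = RingHomomorphism f

data Expr {k} (K : Set k) (V : Set) : Set k where
  con : K → Expr K V
  var : V → Expr K V
  _⊕_ : Expr K V → Expr K V → Expr K V
  _⊗_ : Expr K V → Expr K V → Expr K V
  ⊖_  : Expr K V → Expr K V

infixl 6 _⊕_
infixl 7 _⊗_
infix  8 ⊖_

-- The commutative O-algebra with generators V and the single relation lhs = rhs: formal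
-- expressions modulo the least congruence containing the ring axioms and the relation.
module Presentation {c ℓ} (O : CommutativeRing c ℓ) (V : Set) (lhs rhs : Expr (CommutativeRing.Carrier O) V) where
  private
    module O = CommutativeRing O

  Term : Set c
  Term = Expr O.Carrier V

  infix 4 _∼_

  data _∼_ : Term → Term → Set (c ⊔ ℓ) where
    relation    : lhs ∼ rhs
    con-cong    : ∀ {x y} → x O.≈ y → con x ∼ con y
    con-+       : ∀ x y → con (x O.+ y) ∼ con x ⊕ con y
    con-*       : ∀ x y → con (x O.* y) ∼ con x ⊗ con y
    ∼-refl      : ∀ {s} → s ∼ s
    ∼-sym       : ∀ {s t} → s ∼ t → t ∼ s
    ∼-trans     : ∀ {s t u} → s ∼ t → t ∼ u → s ∼ u
    ⊕-cong      : ∀ {s t u v} → s ∼ t → u ∼ v → s ⊕ u ∼ t ⊕ v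
    ⊗-cong      : ∀ {s t u v} → s ∼ t → u ∼ v → s ⊗ u ∼ t ⊗ v
    ⊖-cong      : ∀ {s t} → s ∼ t → ⊖ s ∼ ⊖ t
    ⊕-assoc     : ∀ s t u → (s ⊕ t) ⊕ u ∼ s ⊕ (t ⊕ u)
    ⊕-comm      : ∀ s t → s ⊕ t ∼ t ⊕ s
    ⊕-identityˡ : ∀ s → con O.0# ⊕ s ∼ s
    ⊖-inverseˡ  : ∀ s → ⊖ s ⊕ s ∼ con O.0#
    ⊗-assoc     : ∀ s t u → (s ⊗ t) ⊗ u ∼ s ⊗ (t ⊗ u)
    ⊗-comm      : ∀ s t → s ⊗ t ∼ t ⊗ s
    ⊗-identityˡ : ∀ s → con O.1# ⊗ s ∼ s
    distribˡ    : ∀ s t u → s ⊗ (t ⊕ u) ∼ s ⊗ t ⊕ s ⊗ u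

  presented : CommutativeRing c (c ⊔ ℓ)
  presented = record
    { Carrier = Term
    ; _≈_ = _∼_
    ; _+_ = _⊕_
    ; _*_ = _⊗_
    ; -_  = ⊖_
    ; 0#  = con O.0#
    ; 1#  = con O.1#
    ; isCommutativeRing = record
      { isRing = record
        { +-isAbelianGroup = record
          { isGroup = record
            { isMonoid = record
              { isSemigroup = record
                { isMagma = record
                  { isEquivalence = record { refl = ∼-refl ; sym = ∼-sym ; trans = ∼-trans }
                  ; ∙-cong = ⊕-cong
                  }
                ; assoc = ⊕-assoc
                }
              ; identity = ⊕-identityˡ , λ s → ∼-trans (⊕-comm _ _) (⊕-identityˡ s)
              }
            ; inverse = ⊖-inverseˡ , λ s → ∼-trans (⊕-comm _ _) (⊖-inverseˡ s)
            ; ⁻¹-cong = ⊖-cong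
            }
          ; comm = ⊕-comm
          }
        ; *-cong     = ⊗-cong
        ; *-assoc    = ⊗-assoc
        ; *-identity = ⊗-identityˡ , λ s → ∼-trans (⊗-comm _ _) (⊗-identityˡ s)
        ; distrib    = distribˡ , λ s t u → ∼-trans (⊗-comm _ _)
                         (∼-trans (distribˡ s t u) (⊕-cong (⊗-comm _ _) (⊗-comm _ _)))
        }
      ; *-comm = ⊗-comm
      }
    }

  structureMap : O ⟶ presented
  structureMap = mkHom O presented con con-cong con-+ con-* ∼-refl

  module _ {b ℓb} (B : CommutativeRing b ℓb) (f : O ⟶ B) (ρ : V → CommutativeRing.Carrier B) where
    private
      module B = CommutativeRing B
      module f = RingHomomorphism f

    evaluate : Term → B.Carrier
    evaluate (con x) = ⟦ f ⟧ x
    evaluate (var v) = ρ v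
    evaluate (s ⊕ t) = evaluate s B.+ evaluate t
    evaluate (s ⊗ t) = evaluate s B.* evaluate t
    evaluate (⊖ s)   = B.- evaluate s

    module _ (satisfied : evaluate lhs B.≈ evaluate rhs) where

      abstract
        evaluate-cong : ∀ {s t} → s ∼ t → evaluate s B.≈ evaluate t
        evaluate-cong relation          = satisfied
        evaluate-cong (con-cong x≈y)    = f.⟦⟧-cong x≈y
        evaluate-cong (con-+ x y)       = f.+-homo x y
        evaluate-cong (con-* x y)       = f.*-homo x y
        evaluate-cong ∼-refl            = B.refl
        evaluate-cong (∼-sym e)         = B.sym (evaluate-cong e)
        evaluate-cong (∼-trans d e)     = B.trans (evaluate-cong d) (evaluate-cong e)
        evaluate-cong (⊕-cong d e)      = B.+-cong (evaluate-cong d) (evaluate-cong e)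
        evaluate-cong (⊗-cong d e)      = B.*-cong (evaluate-cong d) (evaluate-cong e)
        evaluate-cong (⊖-cong e)        = B.-‿cong (evaluate-cong e)
        evaluate-cong (⊕-assoc s t u)   = B.+-assoc _ _ _
        evaluate-cong (⊕-comm s t)      = B.+-comm _ _
        evaluate-cong (⊕-identityˡ s)   = B.trans (B.+-congʳ f.0#-homo) (B.+-identityˡ _)
        evaluate-cong (⊖-inverseˡ s)    = B.trans (B.-‿inverseˡ _) (B.sym f.0#-homo)
        evaluate-cong (⊗-assoc s t u)   = B.*-assoc _ _ _
        evaluate-cong (⊗-comm s t)      = B.*-comm _ _
        evaluate-cong (⊗-identityˡ s)   = B.trans (B.*-congʳ f.1#-homo) (B.*-identityˡ _)
        evaluate-cong (distribˡ s t u)  = B.distribˡ _ _ _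

      evaluation : presented ⟶ B
      evaluation = mkHom presented B evaluate evaluate-cong
        (λ _ _ → B.refl) (λ _ _ → B.refl) f.1#-homo

module Matrices {c ℓ} (A : CommutativeRing c ℓ) where
  open CommutativeRing A hiding (zero)
  open CommutativeRingTheory A
  open SetoidReasoning setoid

  Matrix : Set c
  Matrix = Fin 2 → Fin 2 → Carrier

  infix  4 _≈ᴹ_
  infixl 7 _·_
  infix  8 _ᵗ

  _≈ᴹ_ : Matrix → Matrix → Set ℓ
  M ≈ᴹ N = ∀ i j → M i j ≈ N i j

  matrix : (a b c d : Carrier) → Matrix
  matrix a b c d 0F 0F = a
  matrix a b c d 0F 1F = b
  matrix a b c d 1F 0F = c
  matrix a b c d 1F 1F = d

  _·_ : Matrix → Matrix → Matrix
  (M · N) i j = M i 0F * N 0F j + M i 1F * N 1F j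

  _ᵗ : Matrix → Matrix
  (M ᵗ) i j = M j i

  det : Matrix → Carrier
  det M = M 0F 0F * M 1F 1F - M 0F 1F * M 1F 0F

  _^⟨_⟩ : Matrix → ℕ → Matrix
  (M ^⟨ n ⟩) i j = M i j ^ n

  record SymmetricGL₂ : Set (c ⊔ ℓ) where
    field
      entries   : Matrix
      symmetric : entries ᵗ ≈ᴹ entries
      det-unit  : IsUnit (det entries)

  scalar : Unit → SymmetricGL₂
  scalar d = record
    { entries   = matrix (value d) 0# 0# (value d)
    ; symmetric = λ { 0F 0F → refl ; 0F 1F → refl ; 1F 0F → refl ; 1F 1F → refl }
    ; det-unit  = invert-cong
        (sym (trans (+-congˡ (trans (-‿cong (zeroˡ 0#)) ε⁻¹≈ε)) (+-identityʳ _)))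
        (invert-* (isUnit d) (isUnit d))
    }
    where open AbelianGroupProperties +-abelianGroup using (ε⁻¹≈ε)

  private
    open RingProperties ring using (-‿distribˡ-*; -‿distribʳ-*)
    open AbelianGroupProperties +-abelianGroup using (⁻¹-∙-comm; ⁻¹-involutive; ε⁻¹≈ε)
    open CommutativeSemigroupProperties +-commutativeSemigroup using (interchange)

    subtract : ∀ {s t u v} → s + v ≈ u + t → s - t ≈ u - v
    subtract {s} {t} {u} {v} eq = begin
      s + - t                  ≈⟨ +-identityʳ _ ⟨
      (s + - t) + 0#           ≈⟨ +-congˡ (-‿inverseʳ v) ⟨
      (s + - t) + (v + - v)    ≈⟨ interchange _ _ _ _ ⟩
      (s + v) + (- t + - v)    ≈⟨ +-congʳ eq ⟩
      (u + t) + (- t + - v)    ≈⟨ +-congˡ (+-comm _ _) ⟩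
      (u + t) + (- v + - t)    ≈⟨ interchange _ _ _ _ ⟩
      (u + - v) + (t + - t)    ≈⟨ +-congˡ (-‿inverseʳ t) ⟩
      (u + - v) + 0#           ≈⟨ +-identityʳ _ ⟩
      u + - v                  ∎

    expand : ∀ s t u v → (s - t) * (u - v) ≈ (s * u + t * v) - (s * v + t * u)
    expand s t u v = begin
      (s + - t) * (u + - v)                                  ≈⟨ distribʳ _ _ _ ⟩
      s * (u + - v) + - t * (u + - v)                        ≈⟨ +-cong (distribˡ _ _ _) (distribˡ _ _ _) ⟩
      (s * u + s * - v) + (- t * u + - t * - v)              ≈⟨ +-congˡ (+-comm _ _) ⟩
      (s * u + s * - v) + (- t * - v + - t * u)              ≈⟨ interchange _ _ _ _ ⟩
      (s * u + - t * - v) + (s * - v + - t * u)              ≈⟨ +-cong (+-congˡ neg-neg) (+-cong (-‿distribʳ-* s v) (-‿distribˡ-* t u)) ⟨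
      (s * u + t * v) + (- (s * v) + - (t * u))              ≈⟨ +-congˡ (⁻¹-∙-comm _ _) ⟩
      (s * u + t * v) + - (s * v + t * u)                    ∎
      where
      neg-neg : t * v ≈ - t * - v
      neg-neg = sym (trans (sym (-‿distribʳ-* (- t) v))
        (trans (-‿cong (sym (-‿distribˡ-* t v))) (⁻¹-involutive _)))

  abstract
    det-· : ∀ M N → det (M · N) ≈ det M * det N
    det-· M N = trans (subtract (identity (M 0F 0F) (M 0F 1F) (M 1F 0F) (M 1F 1F)
                                          (N 0F 0F) (N 0F 1F) (N 1F 0F) (N 1F 1F)))
                      (sym (expand _ _ _ _))
      where
      open import Algebra.Solver.Ring.NaturalCoefficients.Default commutativeSemiring
        using (solve; _:=_; _:+_; _:*_)
      identity : ∀ a b c d e f g h →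
        (a * e + b * g) * (c * f + d * h) + ((a * d) * (f * g) + (b * c) * (e * h)) ≈
        ((a * d) * (e * h) + (b * c) * (f * g)) + (a * f + b * h) * (c * e + d * g)
      identity = solve 8 (λ a b c d e f g h →
        (a :* e :+ b :* g) :* (c :* f :+ d :* h) :+ ((a :* d) :* (f :* g) :+ (b :* c) :* (e :* h)) :=
        ((a :* d) :* (e :* h) :+ (b :* c) :* (f :* g)) :+ (a :* f :+ b :* h) :* (c :* e :+ d :* g)) refl

    det-ᵗ : ∀ M → det (M ᵗ) ≈ det M
    det-ᵗ M = +-congˡ (-‿cong (*-comm _ _))

    det-^ : ∀ {p} → Prime p → ∀ M → det (M ^⟨ p ⟩) ≡ det M ^ p [mod p ]
    det-^ {p} pp M = mod-sym
      (mod-trans (frobenius-+ A pp _ _)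
      (mod-+ (≈⇒mod (^-distrib-* _ _ p))
             (mod-trans (frobenius-‿ A pp _) (≈⇒mod (-‿cong (^-distrib-* _ _ p))))))
      where open CommutativeExp commutativeSemiring using (^-distrib-*)

module _ {a ℓa b ℓb} (A : CommutativeRing a ℓa) (B : CommutativeRing b ℓb) (f : A ⟶ B) where
  private
    module A = CommutativeRing A
    module B = CommutativeRing B
    module MA = Matrices A
    module MB = Matrices B
    module f = RingHomomorphism f

  mapMatrix : MA.Matrix → MB.Matrix
  mapMatrix M i j = ⟦ f ⟧ (M i j)

  abstract
    det-map : ∀ M → MB.det (mapMatrix M) B.≈ ⟦ f ⟧ (MA.det M)
    det-map M = B.sym (B.trans (f.+-homo _ _)
      (B.+-cong (f.*-homo _ _) (B.trans (f.-‿homo _) (B.-‿cong (f.*-homo _ _)))))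

module _ {c ℓ} (A : CommutativeRing c ℓ) where
  open CommutativeRing A hiding (zero)
  open CommutativeRingTheory A

  -- An integral domain in which every nonzero element is a unit times a power of π; `cancel`
  -- is the absence of zero divisors.  The maximal ideal is then generated by π.
  record IsDVRWithUniformizer (π : Carrier) : Set (c ⊔ ℓ) where
    field
      nontrivial  : ¬ 1# ≈ 0#
      cancel      : Definitions.AlmostLeftCancellative _≈_ 0# _*_
      π≉0         : ¬ π ≈ 0#
      π-nonunit   : ¬ IsUnit π
      factor      : ∀ x → ¬ x ≈ 0# → ∃ λ n → ∃ λ u → x ≈ value u * π ^ n

  record IsAdicallyComplete (p : ℕ) : Set (c ⊔ ℓ) where
    field
      separated : ∀ x → (∀ n → x ≡ 0# [mod p ℕ.^ n ]) → x ≈ 0#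
      converges : ∀ (x : ℕ → Carrier) → (∀ n → x (suc n) ≡ x n [mod p ℕ.^ n ]) →
                  ∃ λ y → ∀ n → y ≡ x n [mod p ℕ.^ n ]

  record IsCompleteDVR (p : ℕ) : Set (c ⊔ ℓ) where
    field
      isDVR      : IsDVRWithUniformizer (p × 1#)
      isComplete : IsAdicallyComplete p

  -- With (p) the maximal ideal: x ↦ xᵖ is bijective on the residue field A/pA.
  PerfectModulo : ℕ → Set (c ⊔ ℓ)
  PerfectModulo p = Bijective (λ x y → x ≡ y [mod p ]) (λ x y → x ≡ y [mod p ]) (_^ p)

  ×-cancel : ∀ {p} → IsDVRWithUniformizer (p × 1#) → ∀ x y → p × x ≈ p × y → x ≈ y
  ×-cancel {p} dvr x y eq = cancel (p × 1#) x y π≉0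
    (trans (as-product x) (trans eq (sym (as-product y))))
    where
    open IsDVRWithUniformizer dvr
    open Mult semiring using (×-assoc-*; ×-congʳ)
    as-product : ∀ x → (p × 1#) * x ≈ p × x
    as-product x = trans (×-assoc-* p 1# x) (×-congʳ p (*-identityˡ x))

module _ {c ℓ} (p : ℕ) (A : CommutativeRing c ℓ) where
  open CommutativeRing A hiding (zero)
  open CommutativeRingTheory A
  open RingMorphisms rawRing rawRing using (IsRingHomomorphism)

  record FrobeniusLift : Set (c ⊔ ℓ) where
    field
      endomorphism : A ⟶ A
      lifts        : ∀ x → ⟦ endomorphism ⟧ x ≡ x ^ p [mod p ]

  -- Used for p-torsion free A, where this is the same as satisfying the sum and product
  -- rules of a p-derivation.
  record PDerivation : Set (c ⊔ ℓ) where
    field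
      δ      : Carrier → Carrier
      δ-cong : ∀ {x y} → x ≈ y → δ x ≈ δ y
      isRingHomomorphism : IsRingHomomorphism (λ x → x ^ p + p × δ x)

  attachedLift : PDerivation → FrobeniusLift
  attachedLift D = record
    { endomorphism = record { isRingHomomorphism = isRingHomomorphism }
    ; lifts        = λ x → δ x , refl
    }
    where open PDerivation D

  attachedDerivation : (∀ x y → p × x ≈ p × y → x ≈ y) → FrobeniusLift → PDerivation
  attachedDerivation ×-cancel φ = record
    { δ      = δ
    ; δ-cong = λ {x} {y} x≈y → ×-cancel (δ x) (δ y) (∙-cancelˡ (x ^ p) _ _
        (trans (sym (φ≈ x)) (trans (φ.⟦⟧-cong x≈y)
          (trans (φ≈ y) (+-congʳ (^-congˡ p (sym x≈y)))))))
    ; isRingHomomorphism = RingHomomorphism.isRingHomomorphism (mkHom A A (λ x → x ^ p + p × δ x)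
        (λ x≈y → trans (sym (φ≈ _)) (trans (φ.⟦⟧-cong x≈y) (φ≈ _)))
        (λ x y → trans (sym (φ≈ _)) (trans (φ.+-homo x y) (+-cong (φ≈ x) (φ≈ y))))
        (λ x y → trans (sym (φ≈ _)) (trans (φ.*-homo x y) (*-cong (φ≈ x) (φ≈ y))))
        (trans (sym (φ≈ 1#)) φ.1#-homo))
    }
    where
    module φ = RingHomomorphism (FrobeniusLift.endomorphism φ)
    open AbelianGroupProperties +-abelianGroup using (∙-cancelˡ)
    open Exp semiring using (^-congˡ)
    δ : Carrier → Carrier
    δ x = Congruent.quotient (FrobeniusLift.lifts φ x)
    φ≈ : ∀ x → φ.⟦ x ⟧ ≈ x ^ p + p × δ x
    φ≈ x = Congruent.equation (FrobeniusLift.lifts φ x)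

data VarG : Set where
  entry : Fin 2 → Fin 2 → VarG
  det⁻¹ : VarG

data VarG′ : Set where
  α β norm⁻¹ : VarG′

module Groups {c ℓ} (p : ℕ) (p-prime : Prime p) (O : CommutativeRing c ℓ) where
  private
    module O = CommutativeRing O
    module TO = CommutativeRingTheory O
    module MO = Matrices O

  -- The localisations O[x, (det x)⁻¹] and O[α, β, (α² + β²)⁻¹], in the form O[V, y] / (f y - 1).
  module PresentationG = Presentation O VarG
    ((var (entry 0F 0F) ⊗ var (entry 1F 1F) ⊕ ⊖ (var (entry 0F 1F) ⊗ var (entry 1F 0F))) ⊗ var det⁻¹)
    (con O.1#)

  module PresentationG′ = Presentation O VarG′
    ((var α ⊗ var α ⊕ var β ⊗ var β) ⊗ var norm⁻¹)
    (con O.1#)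

  O[G] O[G′] : CommutativeRing c (c ⊔ ℓ)
  O[G]  = PresentationG.presented
  O[G′] = PresentationG′.presented

  O[Ĝ] O[Ĝ′] : CommutativeRing (c ⊔ ℓ) (c ⊔ ℓ)
  O[Ĝ]  = completion p O[G]
  O[Ĝ′] = completion p O[G′]

  ιG : O ⟶ O[Ĝ]
  ιG = compose O O[G] O[Ĝ] (diagonal p O[G]) PresentationG.structureMap

  ιG′ : O ⟶ O[Ĝ′]
  ιG′ = compose O O[G′] O[Ĝ′] (diagonal p O[G′]) PresentationG′.structureMap

  x : Matrices.Matrix O[Ĝ]
  x i j = ⟦ diagonal p O[G] ⟧ (var (entry i j))

  α̂ β̂ : CommutativeRing.Carrier O[Ĝ′]
  α̂ = ⟦ diagonal p O[G′] ⟧ (var α)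
  β̂ = ⟦ diagonal p O[G′] ⟧ (var β)

  -- The continuous ring homomorphism that is f on O and sends x to M.  It is determined by
  -- these values, since the inverse of det x must go to the inverse of det M.
  universalG : ∀ {b ℓb} (B : CommutativeRing b ℓb) (f : O ⟶ completion p B)
               (M : Matrices.Matrix (completion p B)) →
               CommutativeRingTheory.IsUnit (completion p B) (Matrices.det (completion p B) M) →
               O[Ĝ] ⟶ completion p B
  universalG B f M (d⁻¹ , _ , dd⁻¹≈1) = extend p O[G] B
    (PresentationG.evaluation (completion p B) f
      (λ { (entry i j) → M i j ; det⁻¹ → d⁻¹ })
      (B̂.trans dd⁻¹≈1 (B̂.sym (RingHomomorphism.1#-homo f))))
    where module B̂ = CommutativeRing (completion p B)

  abstract
    det-x-unit : CommutativeRingTheory.IsUnit O[Ĝ] (Matrices.det O[Ĝ] x)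
    det-x-unit = invert-cong (Ô.sym (det-map O[G] O[Ĝ] (diagonal p O[G]) (λ i j → var (entry i j))))
      (hom-IsUnit O[G] O[Ĝ] (diagonal p O[G])
        (var det⁻¹ , ∼-trans (⊗-comm _ _) relation , relation))
      where
      module Ô = CommutativeRing O[Ĝ]
      open CommutativeRingTheory O[Ĝ] using (invert-cong)
      open PresentationG

  open Matrices O[Ĝ] using (det; det-·; det-ᵗ; det-^; _·_; _ᵗ; _^⟨_⟩)
  open CommutativeRingTheory O[Ĝ] using (invert-cong; invert-*; invert-^)

  𝓗 : MO.SymmetricGL₂ → O[Ĝ] ⟶ O[Ĝ]
  𝓗 q = universalG O[G] ιG (x ᵗ · mapMatrix O O[Ĝ] ιG entries · x)
    (invert-cong (Ô.sym (Ô.trans (det-· (x ᵗ · qG) x) (Ô.*-congʳ (det-· (x ᵗ) qG))))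
      (invert-* (invert-* (invert-cong (Ô.sym (det-ᵗ x)) det-x-unit)
                          (invert-cong (Ô.sym (det-map O O[Ĝ] ιG entries)) (hom-IsUnit O O[Ĝ] ιG det-unit)))
                det-x-unit))
    where
    open MO.SymmetricGL₂ q
    module Ô = CommutativeRing O[Ĝ]
    qG = mapMatrix O O[Ĝ] ιG entries

  -- Since φ is a Frobenius lift and x goes to x⁽ᵖ⁾, this is one too.
  φ₀ : FrobeniusLift p O → O[Ĝ] ⟶ O[Ĝ]
  φ₀ φ = universalG O[G] (compose O O O[Ĝ] ιG (FrobeniusLift.endomorphism φ)) (x ^⟨ p ⟩)
    (unit-mod-p p O[G] (invert-^ p det-x-unit) (det-^ p-prime x))

  norm-unit : CommutativeRingTheory.Unit O[Ĝ′]
  norm-unit = record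
    { value  = α̂ ^ 2 + β̂ ^ 2
    ; isUnit = T′.invert-cong
        (+-cong (*-congˡ (sym (*-identityʳ α̂))) (*-congˡ (sym (*-identityʳ β̂))))
        αα+ββ-unit
    }
    where
    module T′ = CommutativeRingTheory O[Ĝ′]
    open CommutativeRing O[Ĝ′]
    open T′ using (_^_)
    open PresentationG′
    αα+ββ-unit : T′.IsUnit (α̂ * α̂ + β̂ * β̂)
    αα+ββ-unit = T′.invert-cong (pointwise p O[G′] λ _ → ∼-refl)
      (hom-IsUnit O[G′] O[Ĝ′] (diagonal p O[G′]) (var norm⁻¹ , ∼-trans (⊗-comm _ _) relation , relation))

  frobenius-norm-unit : CommutativeRingTheory.Unit O[Ĝ′]
  frobenius-norm-unit = record
    { value  = α̂ ^ (2 ℕ.* p) + β̂ ^ (2 ℕ.* p)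
    ; isUnit = unit-mod-p p O[G′] (T′.isUnit (norm-unit T′.^ᵘ p))
        (T′.mod-sym (T′.mod-trans (frobenius-+ O[Ĝ′] p-prime (α̂ ^ 2) (β̂ ^ 2))
                                  (T′.≈⇒mod (+-cong (^-assocʳ α̂ 2 p) (^-assocʳ β̂ 2 p)))))
    }
    where
    module T′ = CommutativeRingTheory O[Ĝ′]
    open CommutativeRing O[Ĝ′]
    open T′ using (_^_)
    open Exp semiring using (^-assocʳ)

  -- Restriction of functions along x ↦ (α β; -β α); its kernel is the ideal of GL₁ᶜ in GL₂.
  restriction : O[Ĝ] ⟶ O[Ĝ′]
  restriction = universalG O[G′] ιG′ (matrix α̂ β̂ (- β̂) α̂)
    (T′.invert-cong det≈ (T′.isUnit norm-unit))
    where
    module T′ = CommutativeRingTheory O[Ĝ′]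
    open CommutativeRing O[Ĝ′]
    open T′ using (_^_)
    open Matrices O[Ĝ′] using (matrix)
    open RingProperties ring using (-‿distribʳ-*)
    open AbelianGroupProperties +-abelianGroup using (⁻¹-involutive)
    det≈ : α̂ ^ 2 + β̂ ^ 2 ≈ α̂ * α̂ - β̂ * (- β̂)
    det≈ = +-cong (*-congˡ (*-identityʳ α̂))
      (trans (*-congˡ (*-identityʳ β̂))
        (trans (sym (⁻¹-involutive _)) (-‿cong (-‿distribʳ-* β̂ β̂))))

module LeviCivita {c ℓ} (p : ℕ) (p-prime : Prime p) (O : CommutativeRing c ℓ)
                  (O-dvr : IsCompleteDVR O p) (φ : FrobeniusLift p O) where
  open Groups p p-prime O public
  private
    module O = CommutativeRing O
    module TO = CommutativeRingTheory O
    module MO = Matrices O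
    module Ô = CommutativeRing O[Ĝ]
    module Ô′ = CommutativeRing O[Ĝ′]

  δO : PDerivation p O
  δO = attachedDerivation p O (×-cancel O {p} (IsCompleteDVR.isDVR O-dvr)) φ

  record Connection : Set (c ⊔ ℓ) where
    field
      derivation : PDerivation p O[Ĝ]
    open PDerivation derivation using (δ) public
    field
      extends : ∀ a → δ (⟦ ιG ⟧ a) Ô.≈ ⟦ ιG ⟧ (PDerivation.δ δO a)

    φG : O[Ĝ] ⟶ O[Ĝ]
    φG = FrobeniusLift.endomorphism (attachedLift p O[Ĝ] derivation)

  IsMetric : Connection → MO.SymmetricGL₂ → Set (c ⊔ ℓ)
  IsMetric D q = ∀ f → ⟦ Connection.φG D ⟧ (⟦ 𝓗 q ⟧ f) Ô.≈ ⟦ 𝓗 q ⟧ (⟦ φ₀ φ ⟧ f)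

  Γ : Connection → MO.SymmetricGL₂ → Matrices.Matrix O[Ĝ]
  Γ D q = δx ᵗ · φq · (x ^⟨ p ⟩)
    where
    open Matrices O[Ĝ]
    δx φq : Matrix
    δx i j = Connection.δ D (x i j)
    φq = mapMatrix O O[Ĝ] (compose O O O[Ĝ] ιG (FrobeniusLift.endomorphism φ)) (MO.SymmetricGL₂.entries q)

  record IsLeviCivita (q : Fin 2 → MO.SymmetricGL₂) (D : Fin 2 → Connection) : Set (c ⊔ ℓ) where
    field
      metric    : ∀ i → IsMetric (D i) (q i)
      symmetric : ∀ i j k → Γ (D i) (q i) j k Ô.≈ Γ (D j) (q j) i k

  -- The defining ideal of GL₁ᶜ is the kernel of the restriction, so `induced` says that D′ i is
  -- the p-derivation that connection i induces on the quotient.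
  record IsLeviCivita′ (d : Fin 2 → TO.Unit) (D′ : Fin 2 → PDerivation p O[Ĝ′]) : Set (c ⊔ ℓ) where
    field
      connection   : Fin 2 → Connection
      isLeviCivita : IsLeviCivita (λ i → MO.scalar (d i)) connection
      induced      : ∀ i f → PDerivation.δ (D′ i) (⟦ restriction ⟧ f) Ô′.≈ ⟦ restriction ⟧ (Connection.δ (connection i) f)

{-# OPTIONS --safe #-}
module Submission where

-- Identify the matrix (α β; -β α) with α + βi.  Then φᵢ(α + βi) = (αᵖ + βᵖi)(uᵢ + vᵢi) for some
-- uᵢ, vᵢ, because αᵖ + βᵖi has the unit norm α²ᵖ + β²ᵖ; and vᵢ is divisible by p.  The restriction
-- of pΓᵢ to G′ is φ(dᵢ) times (φᵢx - x⁽ᵖ⁾)ᵗ x⁽ᵖ⁾, so the symmetry of Γ reads v₁ = ε(u₂ - 1) and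
-- u₁ - 1 = -εv₂.  The metric condition at the entry x₁₁ reads uᵢ² + vᵢ² = θᵢ; eliminating u₁ and
-- u₂ gives the quadratic system.  Indices 1, 2 are 0F, 1F below.

open import Defs
open import Level using (Level; _⊔_)
open import Algebra.Bundles using (CommutativeRing)
open import Algebra.Morphism.Bundles using (RingHomomorphism)
import Algebra.Properties.CommutativeSemigroup as CommutativeSemigroupProperties
import Algebra.Properties.CommutativeSemiring.Exp as CommutativeExp
import Algebra.Properties.Ring as RingProperties
import Algebra.Properties.Semiring.Exp as Exp
import Algebra.Properties.Semiring.Mult as Mult
import Algebra.Properties.Semiring.Mult.TCOptimised as MultTC
import Algebra.Solver.Ring as RingSolver
open import Algebra.Solver.Ring.AlmostCommutativeRing using (fromCommutativeRing; _-Raw-AlmostCommutative⟶_)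
open import Data.Fin.Base using (Fin)
open import Data.Fin.Patterns using (0F; 1F)
open import Data.Integer.Base as ℤ using (ℤ; +_; -[1+_])
import Data.Integer.Properties as ℤ
open import Data.Maybe.Base using (just; nothing)
open import Data.Nat.Base as ℕ using (ℕ; zero; suc)
import Data.Nat.Properties as ℕ
open import Data.Nat.DivMod using (_%_; _/_; m≡m%n+[m/n]*n; m%n<n)
open import Data.Nat.Divisibility using (_∣_; divides)
open import Data.Nat.Primality using (Prime)
open import Data.Product.Base using (∃; _×_; _,_; proj₁; proj₂)
open import Data.Sign.Base as Sign using ()
open import Relation.Binary.Definitions using (WeaklyDecidable)
import Relation.Binary.PropositionalEquality.Core as ≡
import Relation.Binary.Reasoning.Setoid as SetoidReasoning
open import Relation.Nullary.Decidable.Core using (yes; no)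
open import Relation.Nullary.Negation.Core using (¬_; contradiction)

open RingHomomorphism using (⟦_⟧)

-- The pair (v₁, v₂) is not constructed by a Hensel argument. The connection already provides the
-- lifts φᵢ, and the vᵢ read off from the quotients φᵢ(α + βi) / (αᵖ + βᵖi) satisfy the system;
-- uniqueness among solutions divisible by p then makes them the pair of the theorem. Uniqueness
-- rests on 2 and ε being units, so that modulo p the linear terms decide. Completeness enters
-- through one fact, that an element congruent to a unit modulo p is a unit: it gives the
-- invertibility of α²ᵖ + β²ᵖ, of 2, and of the factor met in the uniqueness argument. Γ is
-- multiplied by p because p δy = φy - yᵖ expresses it through the lift. Oddness of p serves twice,
-- for 2 being a unit and for (-β)ᵖ = -βᵖ. The algebra is done over arbitrary commutative rings and
-- meets the completed coordinate rings only at the end.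

module IntegerSolver {c ℓ} (R : CommutativeRing c ℓ) where
  open CommutativeRing R hiding (zero)
  open MultTC semiring using (1+×; ×-homo-+; ×1-homo-*) renaming (_×_ to _×′_)
  open RingProperties ring using (-‿distribˡ-*; -‿distribʳ-*; -0#≈0#; -‿involutive; -‿+-comm)
  open CommutativeSemigroupProperties +-commutativeSemigroup using (interchange)
  open SetoidReasoning setoid

  -- With the optimised multiples `1 ×′ 1#` reduces to `1#`, so the solver constants 0 and 1 are
  -- `0#` and `1#` by computation.
  fromℤ : ℤ → Carrier
  fromℤ (+ n)    = n ×′ 1#
  fromℤ -[1+ n ] = - (suc n ×′ 1#)

  fromℤ-⊖ : ∀ m n → fromℤ (m ℤ.⊖ n) ≈ m ×′ 1# - n ×′ 1#
  fromℤ-⊖ zero    zero    = sym (-‿inverseʳ 0#)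
  fromℤ-⊖ zero    (suc n) = sym (+-identityˡ _)
  fromℤ-⊖ (suc m) zero    = sym (trans (+-congˡ -0#≈0#) (+-identityʳ _))
  fromℤ-⊖ (suc m) (suc n) = begin
    fromℤ (suc m ℤ.⊖ suc n)                   ≡⟨ ≡.cong fromℤ (ℤ.[1+m]⊖[1+n]≡m⊖n m n) ⟩
    fromℤ (m ℤ.⊖ n)                           ≈⟨ fromℤ-⊖ m n ⟩
    m ×′ 1# - n ×′ 1#                         ≈⟨ +-identityˡ _ ⟨
    0# + (m ×′ 1# - n ×′ 1#)                  ≈⟨ +-congʳ (-‿inverseʳ 1#) ⟨
    (1# - 1#) + (m ×′ 1# - n ×′ 1#)           ≈⟨ interchange _ _ _ _ ⟩
    (1# + m ×′ 1#) + (- 1# - n ×′ 1#)         ≈⟨ +-congˡ (-‿+-comm _ _) ⟩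
    (1# + m ×′ 1#) - (1# + n ×′ 1#)           ≈⟨ +-cong (1+× m 1#) (-‿cong (1+× n 1#)) ⟨
    suc m ×′ 1# - suc n ×′ 1#                 ∎

  fromℤ-neg : ∀ z → fromℤ (ℤ.- z) ≈ - fromℤ z
  fromℤ-neg (+ zero)  = sym -0#≈0#
  fromℤ-neg (+ suc n) = refl
  fromℤ-neg -[1+ n ]  = sym (-‿involutive _)

  fromℤ-+ : ∀ y z → fromℤ (y ℤ.+ z) ≈ fromℤ y + fromℤ z
  fromℤ-+ (+ m)    (+ n)    = ×-homo-+ 1# m n
  fromℤ-+ (+ m)    -[1+ n ] = fromℤ-⊖ m (suc n)
  fromℤ-+ -[1+ m ] (+ n)    = trans (fromℤ-⊖ n (suc m)) (+-comm _ _)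
  fromℤ-+ -[1+ m ] -[1+ n ] = begin
    - (suc (suc (m ℕ.+ n)) ×′ 1#)        ≡⟨ ≡.cong (λ k → - (k ×′ 1#)) (≡.cong suc (ℕ.+-suc m n)) ⟨
    - ((suc m ℕ.+ suc n) ×′ 1#)          ≈⟨ -‿cong (×-homo-+ 1# (suc m) (suc n)) ⟩
    - (suc m ×′ 1# + suc n ×′ 1#)        ≈⟨ -‿+-comm _ _ ⟨
    - (suc m ×′ 1#) - suc n ×′ 1#        ∎

  fromℤ-pos : ∀ m n → fromℤ (Sign.+ ℤ.◃ m ℕ.* n) ≈ m ×′ 1# * (n ×′ 1#)
  fromℤ-pos m n = trans (reflexive (≡.cong fromℤ (ℤ.+◃n≡+n (m ℕ.* n)))) (×1-homo-* m n)

  fromℤ-minus : ∀ m n → fromℤ (Sign.- ℤ.◃ m ℕ.* n) ≈ - (m ×′ 1# * (n ×′ 1#))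
  fromℤ-minus m n = trans (reflexive (≡.cong fromℤ (ℤ.-◃n≡-n (m ℕ.* n))))
    (trans (fromℤ-neg (+ (m ℕ.* n))) (-‿cong (×1-homo-* m n)))

  fromℤ-* : ∀ y z → fromℤ (y ℤ.* z) ≈ fromℤ y * fromℤ z
  fromℤ-* (+ m)    (+ n)    = fromℤ-pos m n
  fromℤ-* (+ m)    -[1+ n ] = trans (fromℤ-minus m (suc n)) (-‿distribʳ-* _ _)
  fromℤ-* -[1+ m ] (+ n)    = trans (fromℤ-minus (suc m) n) (-‿distribˡ-* _ _)
  fromℤ-* -[1+ m ] -[1+ n ] = trans (fromℤ-pos (suc m) (suc n))
    (trans (sym (-‿involutive _)) (trans (-‿cong (-‿distribˡ-* _ _)) (-‿distribʳ-* _ _)))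

  homomorphism : CommutativeRing.rawRing ℤ.+-*-commutativeRing -Raw-AlmostCommutative⟶ fromCommutativeRing R
  homomorphism = record
    { ⟦_⟧    = fromℤ
    ; +-homo = fromℤ-+
    ; *-homo = fromℤ-*
    ; -‿homo = fromℤ-neg
    ; 0-homo = refl
    ; 1-homo = refl
    }

  -- Equality in `R` need not be decidable, so coefficients are compared as integers; this suffices
  -- for identities valid in every commutative ring.
  equal? : WeaklyDecidable (λ y z → fromℤ y ≈ fromℤ z)
  equal? y z with y ℤ.≟ z
  ... | yes y≡z = just (reflexive (≡.cong fromℤ y≡z))
  ... | no _    = nothing

  open RingSolver _ _ homomorphism equal? public
    using (solve; _:=_; _:+_; _:*_; _:-_; :-_; _:^_; con; Polynomial)

  :1 : ∀ {n} → Polynomial n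
  :1 = con (+ 1)

odd⇒1+2k : ∀ n → ¬ 2 ∣ n → ∃ λ k → n ≡.≡ suc (k ℕ.* 2)
odd⇒1+2k n 2∤n = n / 2 , go (n % 2) (m%n<n n 2) (m≡m%n+[m/n]*n n 2)
  where
  go : ∀ r → r ℕ.< 2 → n ≡.≡ r ℕ.+ n / 2 ℕ.* 2 → n ≡.≡ suc (n / 2 ℕ.* 2)
  go 0 _ eq = contradiction (divides (n / 2) eq) 2∤n
  go 1 _ eq = eq
  go (suc (suc _)) (ℕ.s≤s (ℕ.s≤s ())) _

-- Units, and division by a + bi

module UnitProperties {c ℓ} (R : CommutativeRing c ℓ) where
  open CommutativeRing R
  open CommutativeRingTheory R using (IsUnit)
  open SetoidReasoning setoid

  IsUnit-factorˡ : ∀ x y → IsUnit (x * y) → IsUnit x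
  IsUnit-factorˡ x y (z , _ , xyz≈1) = y * z , trans (*-comm _ _) inverseʳ , inverseʳ
    where
    inverseʳ : x * (y * z) ≈ 1#
    inverseʳ = trans (sym (*-assoc x y z)) xyz≈1

  *-cancelˡ : ∀ {x y z} → IsUnit x → x * y ≈ x * z → y ≈ z
  *-cancelˡ {x} {y} {z} (w , wx≈1 , _) xy≈xz = begin
    y            ≈⟨ *-identityˡ y ⟨
    1# * y       ≈⟨ *-congʳ wx≈1 ⟨
    (w * x) * y  ≈⟨ *-assoc w x y ⟩
    w * (x * y)  ≈⟨ *-congˡ xy≈xz ⟩
    w * (x * z)  ≈⟨ *-assoc w x z ⟨
    (w * x) * z  ≈⟨ *-congʳ wx≈1 ⟩
    1# * z       ≈⟨ *-identityˡ z ⟩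
    z            ∎

module _ {c ℓ} (R : CommutativeRing c ℓ) where
  open CommutativeRing R
  open CommutativeRingTheory R using (IsUnit)
  open IntegerSolver R
  open SetoidReasoning setoid

  -- The quotient (A + Bi) / (a + bi) is u + vi.
  module GaussianQuotient (a b A B : Carrier) (N-unit : IsUnit (a * a + b * b)) where
    private
      n = proj₁ N-unit
      Nn≈1 = proj₂ (proj₂ N-unit)

    -- A + Bi times the conjugate a - bi, divided by the norm a² + b². Everything is written in
    -- coordinates, so `R` is not extended by i.
    u v : Carrier
    u = (a * A + b * B) * n
    v = (a * B - b * A) * n

    A≈au-bv : A ≈ a * u - b * v
    A≈au-bv = begin
      A                          ≈⟨ *-identityʳ A ⟨
      A * 1#                     ≈⟨ *-congˡ Nn≈1 ⟨
      A * ((a * a + b * b) * n)  ≈⟨ solve 5 (λ a b A B n →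
        A :* ((a :* a :+ b :* b) :* n) :=
        a :* ((a :* A :+ b :* B) :* n) :- b :* ((a :* B :- b :* A) :* n)) refl a b A B n ⟩
      a * u - b * v              ∎

    B≈av+bu : B ≈ a * v + b * u
    B≈av+bu = begin
      B                          ≈⟨ *-identityʳ B ⟨
      B * 1#                     ≈⟨ *-congˡ Nn≈1 ⟨
      B * ((a * a + b * b) * n)  ≈⟨ solve 5 (λ a b A B n →
        B :* ((a :* a :+ b :* b) :* n) :=
        a :* ((a :* B :- b :* A) :* n) :+ b :* ((a :* A :+ b :* B) :* n)) refl a b A B n ⟩
      a * v + b * u              ∎

    -- Since (A - a) + (B - b)i = (a + bi)(u - 1 + vi), multiplying by a - bi leaves the norm times
    -- u - 1 + vi. This product is the form in which the entries of Γ appear.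
    real-part : (A - a) * a + (B - b) * b ≈ (a * a + b * b) * (u - 1#)
    real-part = begin
      (A - a) * a + (B - b) * b
        ≈⟨ +-cong (*-congʳ (+-congʳ A≈au-bv)) (*-congʳ (+-congʳ B≈av+bu)) ⟩
      (a * u - b * v - a) * a + (a * v + b * u - b) * b
        ≈⟨ solve 4 (λ a b u v →
             (a :* u :- b :* v :- a) :* a :+ (a :* v :+ b :* u :- b) :* b :=
             (a :* a :+ b :* b) :* (u :- :1)) refl a b u v ⟩
      (a * a + b * b) * (u - 1#)  ∎

    imaginary-part : (B - b) * a - (A - a) * b ≈ (a * a + b * b) * v
    imaginary-part = begin
      (B - b) * a - (A - a) * b
        ≈⟨ +-cong (*-congʳ (+-congʳ B≈av+bu)) (-‿cong (*-congʳ (+-congʳ A≈au-bv))) ⟩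
      (a * v + b * u - b) * a - (a * u - b * v - a) * b
        ≈⟨ solve 4 (λ a b u v →
             (a :* v :+ b :* u :- b) :* a :- (a :* u :- b :* v :- a) :* b :=
             (a :* a :+ b :* b) :* v) refl a b u v ⟩
      (a * a + b * b) * v  ∎

    norm : A * A + B * B ≈ (a * a + b * b) * (u * u + v * v)
    norm = begin
      A * A + B * B
        ≈⟨ +-cong (*-cong A≈au-bv A≈au-bv) (*-cong B≈av+bu B≈av+bu) ⟩
      (a * u - b * v) * (a * u - b * v) + (a * v + b * u) * (a * v + b * u)
        ≈⟨ solve 4 (λ a b u v →
             (a :* u :- b :* v) :* (a :* u :- b :* v) :+ (a :* v :+ b :* u) :* (a :* v :+ b :* u) :=
             (a :* a :+ b :* b) :* (u :* u :+ v :* v)) refl a b u v ⟩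
      (a * a + b * b) * (u * u + v * v)  ∎

-- For z = α + βi and φ′ acting entrywise, the real and imaginary parts of (φ′ z − zᵖ) times the
-- conjugate of zᵖ, where zᵖ stands for αᵖ + βᵖi.
module LiftIncrement {c ℓ} (R : CommutativeRing c ℓ) (p : ℕ)
                     (α β : CommutativeRing.Carrier R) (φ′ : R ⟶ R) where
  open CommutativeRing R
  open CommutativeRingTheory R using (_^_)

  real imaginary : Carrier
  real      = (⟦ φ′ ⟧ α - α ^ p) * α ^ p + (⟦ φ′ ⟧ β - β ^ p) * β ^ p
  imaginary = (⟦ φ′ ⟧ β - β ^ p) * α ^ p - (⟦ φ′ ⟧ α - α ^ p) * β ^ p

-- The quadratic system: uniqueness, and the solution given by a pair of lifts

module QuadraticSystem {c ℓ} (R : CommutativeRing c ℓ) (p : ℕ) where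
  open CommutativeRing R
  open CommutativeRingTheory R renaming (_×_ to _•_)
  open Exp semiring using (^-homo-*; ^-congʳ)
  open Mult semiring using (×1-homo-*; ×-congˡ)
  open LiftIncrement R
  open Matrices R using (matrix; _≈ᴹ_; _·_)
  open RingProperties ring using (-‿distribʳ-*; -‿distribˡ-*; +-cancelˡ)
  open IntegerSolver R
  open UnitProperties R
  open SetoidReasoning setoid

  IsSolution : (ε θ₀ θ₁ x₁ x₂ : Carrier) → Set (c ⊔ ℓ)
  IsSolution ε θ₀ θ₁ x₁ x₂ =
    x₁ ≡ 0# [mod p ] ×
    x₂ ≡ 0# [mod p ] ×
    (x₁ ^ 2 - 2 • (ε * x₂) + ε ^ 2 * x₂ ^ 2 ≈ θ₀ - 1#) ×
    (x₁ ^ 2 + 2 • (ε * x₁) + ε ^ 2 * x₂ ^ 2 ≈ ε ^ 2 * (θ₁ - 1#))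

  module _ (unit-mod-p : ∀ {x u} → IsUnit u → x ≡ u [mod p ] → IsUnit x) (p-odd : ¬ 2 ∣ p) where

    -- Writing p = 1 + 2k, the product 2(-k) = 1 - p is congruent to 1 modulo p, hence a unit, and
    -- so is its factor 2.
    two-unit : IsUnit (1# + 1#)
    two-unit = IsUnit-factorˡ (1# + 1#) (- (k • 1#))
      (unit-mod-p (1# , *-identityˡ 1# , *-identityˡ 1#) (- 1# , equation))
      where
      k = proj₁ (odd⇒1+2k p p-odd)
      equation : (1# + 1#) * - (k • 1#) ≈ 1# + p • (- 1#)
      equation = sym (begin
        1# + p • (- 1#)             ≈⟨ +-congˡ (×-‿ p 1#) ⟩
        1# - p • 1#                 ≈⟨ +-congˡ (-‿cong (×-congˡ (proj₂ (odd⇒1+2k p p-odd)))) ⟩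
        1# - (1# + (k ℕ.* 2) • 1#)  ≈⟨ +-congˡ (-‿cong (+-congˡ (×1-homo-* k 2))) ⟩
        1# - (1# + k • 1# * (2 • 1#))
          ≈⟨ solve 1 (λ x → :1 :- (:1 :+ x :* (:1 :+ (:1 :+ con (+ 0)))) := (:1 :+ :1) :* (:- x)) refl (k • 1#) ⟩
        (1# + 1#) * - (k • 1#)      ∎)

    -- Subtracting the equations for two solutions gives D₁ + D₂ = 0 for the differences, and then
    -- the second equation becomes a unit times D₁ = 0.
    solution-unique : ∀ {ε θ₀ θ₁ v₁ v₂ w₁ w₂} → IsUnit ε →
      IsSolution ε θ₀ θ₁ v₁ v₂ → IsSolution ε θ₀ θ₁ w₁ w₂ → (w₁ ≈ v₁) × (w₂ ≈ v₂)
    solution-unique {ε} {θ₀} {θ₁} {v₁} {v₂} {w₁} {w₂} ε-unit (v₁≡0 , v₂≡0 , v-eq₁ , v-eq₂) (w₁≡0 , w₂≡0 , w-eq₁ , w-eq₂) =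
      w₁≈v₁ , +-cancelˡ v₁ w₂ v₂ (trans (+-congʳ (sym w₁≈v₁)) sum≈)
      where
      first second : Carrier → Carrier → Carrier
      first  x₁ x₂ = x₁ ^ 2 - 2 • (ε * x₂) + ε ^ 2 * x₂ ^ 2
      second x₁ x₂ = x₁ ^ 2 + 2 • (ε * x₁) + ε ^ 2 * x₂ ^ 2

      -- The two equations have the same quadratic part, so their difference is linear. The summands
      -- `con (+ 0)` are there because `2 • y` unfolds to `y + (y + 0#)`.
      difference : ∀ x₁ x₂ → second x₁ x₂ - first x₁ x₂ ≈ ((1# + 1#) * ε) * (x₁ + x₂)
      difference = solve 3 (λ ε x₁ x₂ →
        (x₁ :^ 2 :+ (ε :* x₁ :+ (ε :* x₁ :+ con (+ 0))) :+ ε :^ 2 :* x₂ :^ 2)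
        :- (x₁ :^ 2 :- (ε :* x₂ :+ (ε :* x₂ :+ con (+ 0))) :+ ε :^ 2 :* x₂ :^ 2) :=
        ((:1 :+ :1) :* ε) :* (x₁ :+ x₂)) refl ε

      sum≈ : w₁ + w₂ ≈ v₁ + v₂
      sum≈ = *-cancelˡ (invert-* two-unit ε-unit) (begin
        ((1# + 1#) * ε) * (w₁ + w₂)  ≈⟨ difference w₁ w₂ ⟨
        second w₁ w₂ - first w₁ w₂   ≈⟨ +-cong (trans w-eq₂ (sym v-eq₂)) (-‿cong (trans w-eq₁ (sym v-eq₁))) ⟩
        second v₁ v₂ - first v₁ v₂   ≈⟨ difference v₁ v₂ ⟩
        ((1# + 1#) * ε) * (v₁ + v₂)  ∎)

      -- The coefficient of D₁ in the difference of the second equations once D₂ = -D₁ is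
      -- substituted. All four components are divisible by p, so it is congruent to 2ε.
      factor : Carrier
      factor = (1# + 1#) * ε + ((w₁ + v₁) - ε * ε * (w₂ + v₂))

      factor-unit : IsUnit factor
      factor-unit = unit-mod-p (invert-* two-unit ε-unit)
        (mod-trans (mod-+ (≈⇒mod refl)
          (mod-+ (mod-+ w₁≡0 v₁≡0) (mod-‿ (mod-* (≈⇒mod (refl {ε * ε})) (mod-+ w₂≡0 v₂≡0)))))
          (≈⇒mod (solve 1 (λ ε → (:1 :+ :1) :* ε :+ ((con (+ 0) :+ con (+ 0)) :- ε :* ε :* (con (+ 0) :+ con (+ 0)))
                                 := (:1 :+ :1) :* ε) refl ε)))

      w₁≈v₁ : w₁ ≈ v₁
      w₁≈v₁ = *-cancelˡ factor-unit (begin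
        factor * w₁
          ≈⟨ solve 5 (λ ε w₁ w₂ v₁ v₂ →
               ((:1 :+ :1) :* ε :+ ((w₁ :+ v₁) :- ε :* ε :* (w₂ :+ v₂))) :* w₁ :=
               ((w₁ :^ 2 :+ (ε :* w₁ :+ (ε :* w₁ :+ con (+ 0))) :+ ε :^ 2 :* w₂ :^ 2)
                 :- (v₁ :^ 2 :+ (ε :* v₁ :+ (ε :* v₁ :+ con (+ 0))) :+ ε :^ 2 :* v₂ :^ 2))
               :- ε :* ε :* (w₂ :+ v₂) :* ((w₁ :+ w₂) :- (v₁ :+ v₂))
               :+ ((:1 :+ :1) :* ε :+ ((w₁ :+ v₁) :- ε :* ε :* (w₂ :+ v₂))) :* v₁) refl ε w₁ w₂ v₁ v₂ ⟩
        (second w₁ w₂ - second v₁ v₂) - ε * ε * (w₂ + v₂) * ((w₁ + w₂) - (v₁ + v₂)) + factor * v₁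
          ≈⟨ +-congʳ (+-cong (x≈y⇒x-y≈0 (trans w-eq₂ (sym v-eq₂))) (-‿cong (*-congˡ (x≈y⇒x-y≈0 sum≈)))) ⟩
        0# - ε * ε * (w₂ + v₂) * 0# + factor * v₁
          ≈⟨ solve 2 (λ s t → con (+ 0) :- s :* con (+ 0) :+ t := t) refl (ε * ε * (w₂ + v₂)) (factor * v₁) ⟩
        factor * v₁  ∎)
        where
        x≈y⇒x-y≈0 : ∀ {x y} → x ≈ y → x - y ≈ 0#
        x≈y⇒x-y≈0 {x} {y} x≈y = trans (+-congʳ x≈y) (-‿inverseʳ y)

    -- In the application `e i` is φ(dᵢ), `t i` is the numerator dᵢᵖ(α² + β²)ᵖ of θᵢ, and `ε` is
    -- φ(d₂/d₁).
    module _
      (α β : Carrier) (N′ : Unit) (N′≈ : value N′ ≈ α ^ (2 ℕ.* p) + β ^ (2 ℕ.* p))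
      (φ′ : Fin 2 → R ⟶ R) (φ′-lifts : ∀ i y → ⟦ φ′ i ⟧ y ≡ y ^ p [mod p ])
      (e : Fin 2 → Unit) (ε : Unit) (εe₀≈e₁ : value ε * value (e 0F) ≈ value (e 1F))
      (t : Fin 2 → Carrier)
      (metric : ∀ i → t i ≈ value (e i) * (⟦ φ′ i ⟧ α * ⟦ φ′ i ⟧ α + ⟦ φ′ i ⟧ β * ⟦ φ′ i ⟧ β))
      (symmetry₀ : value (e 0F) * imaginary p α β (φ′ 0F) ≈ value (e 1F) * real p α β (φ′ 1F))
      (symmetry₁ : value (e 0F) * real p α β (φ′ 0F) ≈ - (value (e 1F) * imaginary p α β (φ′ 1F)))
      where
      private
        a = α ^ p
        b = β ^ p
        N = a * a + b * b

        A B : Fin 2 → Carrier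
        A i = ⟦ φ′ i ⟧ α
        B i = ⟦ φ′ i ⟧ β

        ^-double : ∀ y → y ^ (2 ℕ.* p) ≈ y ^ p * y ^ p
        ^-double y = trans (^-homo-* y p (p ℕ.+ 0)) (*-congˡ (^-congʳ y (ℕ.+-identityʳ p)))

        N-unit : IsUnit N
        N-unit = invert-cong (trans N′≈ (+-cong (^-double α) (^-double β))) (isUnit N′)

        module Q (i : Fin 2) = GaussianQuotient R a b (A i) (B i) N-unit
        open Q using (u; v)
        e₀ = value (e 0F)
        e₁ = value (e 1F)
        ε₀ = value ε
        ε⁻¹ = value (inverse ε)
        v₁ = v 0F
        v₂ = v 1F

      -- Modulo p the lift sends α, β to a, b, so the numerator aB - bA of v becomes ab - ba.
      v≡0 : ∀ i → v i ≡ 0# [mod p ]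
      v≡0 i = mod-trans
        (mod-*ʳ (proj₁ N-unit) (mod-+ (mod-* (≈⇒mod refl) (φ′-lifts i β)) (mod-‿ (mod-* (≈⇒mod refl) (φ′-lifts i α)))))
        (≈⇒mod (solve 3 (λ a b n → (a :* b :- b :* a) :* n := con (+ 0)) refl a b (proj₁ N-unit)))

      -- The inverse is taken of the whole product, as in the theorem, so that the two versions of
      -- θᵢ agree by computation.
      θ : Fin 2 → Carrier
      θ i = t i * value (inverse (e i *ᵘ N′))

      θ≈u²+v² : ∀ i → θ i ≈ u i * u i + v i * v i
      θ≈u²+v² i = begin
        t i * w                                        ≈⟨ *-congʳ (metric i) ⟩
        (e₂ * (A i * A i + B i * B i)) * w             ≈⟨ *-congʳ (*-congˡ (Q.norm i)) ⟩
        (e₂ * (N * (u i * u i + v i * v i))) * w       ≈⟨ *-congʳ (*-congˡ (*-congʳ N≈N′)) ⟩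
        (e₂ * (value N′ * (u i * u i + v i * v i))) * w
          ≈⟨ solve 4 (λ e n s w → (e :* (n :* s)) :* w := (e :* n) :* w :* s) refl e₂ (value N′) (u i * u i + v i * v i) w ⟩
        (e₂ * value N′) * w * (u i * u i + v i * v i)  ≈⟨ *-congʳ (proj₂ (proj₂ (isUnit (e i *ᵘ N′)))) ⟩
        1# * (u i * u i + v i * v i)                   ≈⟨ *-identityˡ _ ⟩
        u i * u i + v i * v i                          ∎
        where
        e₂ = value (e i)
        w = value (inverse (e i *ᵘ N′))
        N≈N′ : N ≈ value N′
        N≈N′ = sym (trans N′≈ (+-cong (^-double α) (^-double β)))

      -- Both parts of the increments carry the factor N, which cancels together with `e₀`. Here
      -- `v₁` is `v 0F`, whereas the u₁ of the name is `u 1F`, the u₂ of the theorem.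
      v₁≈ε[u₁-1] : v₁ ≈ ε₀ * (u 1F - 1#)
      v₁≈ε[u₁-1] = *-cancelˡ (invert-* N-unit (isUnit (e 0F))) (begin
        (N * e₀) * v₁                                    ≈⟨ solve 3 (λ n e v → (n :* e) :* v := e :* (n :* v)) refl N e₀ v₁ ⟩
        e₀ * (N * v₁)                                    ≈⟨ *-congˡ (Q.imaginary-part 0F) ⟨
        e₀ * ((B 0F - b) * a - (A 0F - a) * b)           ≈⟨ symmetry₀ ⟩
        e₁ * ((A 1F - a) * a + (B 1F - b) * b)           ≈⟨ *-congˡ (Q.real-part 1F) ⟩
        e₁ * (N * (u 1F - 1#))                           ≈⟨ *-congʳ εe₀≈e₁ ⟨
        (ε₀ * e₀) * (N * (u 1F - 1#))                    ≈⟨ solve 4 (λ n e ε u → (ε :* e) :* (n :* u) := (n :* e) :* (ε :* u)) refl N e₀ ε₀ (u 1F - 1#) ⟩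
        (N * e₀) * (ε₀ * (u 1F - 1#))                    ∎)

      u₀-1≈-εv₂ : u 0F - 1# ≈ - (ε₀ * v₂)
      u₀-1≈-εv₂ = *-cancelˡ (invert-* N-unit (isUnit (e 0F))) (begin
        (N * e₀) * (u 0F - 1#)                           ≈⟨ solve 3 (λ n e v → (n :* e) :* v := e :* (n :* v)) refl N e₀ (u 0F - 1#) ⟩
        e₀ * (N * (u 0F - 1#))                           ≈⟨ *-congˡ (Q.real-part 0F) ⟨
        e₀ * ((A 0F - a) * a + (B 0F - b) * b)           ≈⟨ symmetry₁ ⟩
        - (e₁ * ((B 1F - b) * a - (A 1F - a) * b))       ≈⟨ -‿cong (*-congˡ (Q.imaginary-part 1F)) ⟩
        - (e₁ * (N * v₂))                                ≈⟨ -‿cong (*-congʳ εe₀≈e₁) ⟨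
        - ((ε₀ * e₀) * (N * v₂))                         ≈⟨ solve 4 (λ n e ε v → :- ((ε :* e) :* (n :* v)) := (n :* e) :* (:- (ε :* v))) refl N e₀ ε₀ v₂ ⟩
        (N * e₀) * - (ε₀ * v₂)                           ∎)

      u₀≈1-εv₂ : u 0F ≈ 1# - ε₀ * v₂
      u₀≈1-εv₂ = begin
        u 0F              ≈⟨ solve 1 (λ u → u := :1 :+ (u :- :1)) refl (u 0F) ⟩
        1# + (u 0F - 1#)  ≈⟨ +-congˡ u₀-1≈-εv₂ ⟩
        1# - ε₀ * v₂      ∎

      u₁≈1+ε⁻¹v₁ : u 1F ≈ 1# + ε⁻¹ * v₁
      u₁≈1+ε⁻¹v₁ = begin
        u 1F                             ≈⟨ solve 1 (λ u → u := :1 :+ :1 :* (u :- :1)) refl (u 1F) ⟩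
        1# + 1# * (u 1F - 1#)            ≈⟨ +-congˡ (*-congʳ (proj₁ (proj₂ (isUnit ε)))) ⟨
        1# + (ε⁻¹ * ε₀) * (u 1F - 1#)    ≈⟨ +-congˡ (*-assoc _ _ _) ⟩
        1# + ε⁻¹ * (ε₀ * (u 1F - 1#))    ≈⟨ +-congˡ (*-congˡ v₁≈ε[u₁-1]) ⟨
        1# + ε⁻¹ * v₁                    ∎

      equation₁ : v₁ ^ 2 - 2 • (ε₀ * v₂) + ε₀ ^ 2 * v₂ ^ 2 ≈ θ 0F - 1#
      equation₁ = begin
        v₁ ^ 2 - 2 • (ε₀ * v₂) + ε₀ ^ 2 * v₂ ^ 2
          ≈⟨ solve 3 (λ ε v₁ v₂ →
               v₁ :^ 2 :- (ε :* v₂ :+ (ε :* v₂ :+ con (+ 0))) :+ ε :^ 2 :* v₂ :^ 2 :=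
               (:1 :- ε :* v₂) :* (:1 :- ε :* v₂) :+ v₁ :* v₁ :- :1) refl ε₀ v₁ v₂ ⟩
        (1# - ε₀ * v₂) * (1# - ε₀ * v₂) + v₁ * v₁ - 1#
          ≈⟨ +-congʳ (+-congʳ (*-cong u₀≈1-εv₂ u₀≈1-εv₂)) ⟨
        u 0F * u 0F + v₁ * v₁ - 1#
          ≈⟨ +-congʳ (θ≈u²+v² 0F) ⟨
        θ 0F - 1#  ∎

      -- Substituting for v₁ instead of u₂ avoids ε⁻¹; a common factor ε² comes out, which explains
      -- the one on the right.
      equation₂ : v₁ ^ 2 + 2 • (ε₀ * v₁) + ε₀ ^ 2 * v₂ ^ 2 ≈ ε₀ ^ 2 * (θ 1F - 1#)
      equation₂ = begin
        v₁ ^ 2 + 2 • (ε₀ * v₁) + ε₀ ^ 2 * v₂ ^ 2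
          ≈⟨ +-congʳ (+-cong (*-cong v₁≈ε[u₁-1] (*-congʳ v₁≈ε[u₁-1]))
                             (+-cong (*-congˡ v₁≈ε[u₁-1]) (+-congʳ (*-congˡ v₁≈ε[u₁-1])))) ⟩
        (ε₀ * (u 1F - 1#)) ^ 2 + 2 • (ε₀ * (ε₀ * (u 1F - 1#))) + ε₀ ^ 2 * v₂ ^ 2
          ≈⟨ solve 3 (λ ε u v →
               (ε :* (u :- :1)) :^ 2 :+ (ε :* (ε :* (u :- :1)) :+ (ε :* (ε :* (u :- :1)) :+ con (+ 0))) :+ ε :^ 2 :* v :^ 2 :=
               ε :^ 2 :* (u :* u :+ v :* v :- :1)) refl ε₀ (u 1F) v₂ ⟩
        ε₀ ^ 2 * (u 1F * u 1F + v₂ * v₂ - 1#)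
          ≈⟨ *-congˡ (+-congʳ (θ≈u²+v² 1F)) ⟨
        ε₀ ^ 2 * (θ 1F - 1#)  ∎

      -- `w` is free because u₁ and u₂ are expressed differently, through v₂ and v₁. The second row
      -- repeats the first up to sign, as a ring homomorphism preserves negation.
      lift-factorisation : ∀ i {w} → u i ≈ w →
        mapMatrix R R (φ′ i) (matrix α β (- β) α) ≈ᴹ matrix a b (- b) a · matrix w (v i) (- v i) w
      lift-factorisation i {w} u≈w = entries
        where
        A≈ : A i ≈ a * w - b * v i
        A≈ = trans (Q.A≈au-bv i) (+-congʳ (*-congˡ u≈w))
        B≈ : B i ≈ a * v i + b * w
        B≈ = trans (Q.B≈av+bu i) (+-congˡ (*-congˡ u≈w))
        entries : mapMatrix R R (φ′ i) (matrix α β (- β) α) ≈ᴹ matrix a b (- b) a · matrix w (v i) (- v i) w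
        entries 0F 0F = trans A≈ (+-congˡ (-‿distribʳ-* b (v i)))
        entries 0F 1F = B≈
        entries 1F 0F = trans (RingHomomorphism.-‿homo (φ′ i) β) (trans (-‿cong B≈)
          (solve 4 (λ a b w v → :- (a :* v :+ b :* w) := (:- b) :* w :+ a :* (:- v)) refl a b w (v i)))
        entries 1F 1F = trans A≈ (trans (+-comm _ _) (+-congʳ (-‿distribˡ-* b (v i))))

      unique-solution-and-lifts : ∃ λ v₁ → ∃ λ v₂ →
        IsSolution ε₀ (θ 0F) (θ 1F) v₁ v₂ ×
        (∀ w₁ w₂ → IsSolution ε₀ (θ 0F) (θ 1F) w₁ w₂ → (w₁ ≈ v₁) × (w₂ ≈ v₂)) ×
        (let u₂ = 1# + ε⁻¹ * v₁
             u₁ = 1# - ε₀ * v₂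
         in
         (mapMatrix R R (φ′ 0F) (matrix α β (- β) α) ≈ᴹ matrix a b (- b) a · matrix u₁ v₁ (- v₁) u₁) ×
         (mapMatrix R R (φ′ 1F) (matrix α β (- β) α) ≈ᴹ matrix a b (- b) a · matrix u₂ v₂ (- v₂) u₂))
      unique-solution-and-lifts = v₁ , v₂ , solution ,
        (λ w₁ w₂ → solution-unique (isUnit ε) solution) ,
        lift-factorisation 0F u₀≈1-εv₂ , lift-factorisation 1F u₁≈1+ε⁻¹v₁
        where
        solution : IsSolution ε₀ (θ 0F) (θ 1F) v₁ v₂
        solution = v≡0 0F , v≡0 1F , equation₁ , equation₂

-- Homomorphisms, signs, and lifts attached to p-derivations

module _ {a ℓa b ℓb} (A : CommutativeRing a ℓa) (B : CommutativeRing b ℓb) (f : A ⟶ B) where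
  private
    module B = CommutativeRing B
    module TA = CommutativeRingTheory A
    module TB = CommutativeRingTheory B
    module f = RingHomomorphism f

  hom-^ : ∀ x n → ⟦ f ⟧ (x TA.^ n) B.≈ ⟦ f ⟧ x TB.^ n
  hom-^ x zero    = f.1#-homo
  hom-^ x (suc n) = B.trans (f.*-homo x (x TA.^ n)) (B.*-congˡ (hom-^ x n))

module _ {c ℓ} (R : CommutativeRing c ℓ) where
  open CommutativeRing R
  open CommutativeRingTheory R using (_^_) renaming (_×_ to _•_)
  open Mult semiring using (×-congʳ; ×-assoc-*)
  open RingProperties ring using (-‿distribˡ-*)
  open IntegerSolver R
  open SetoidReasoning setoid

  -- The matrix x⁽ᵖ⁾ restricts to one with an entry (-β)ᵖ; this makes it the matrix of αᵖ + βᵖi.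
  -‿^-odd : ∀ n → ¬ 2 ∣ n → ∀ x → (- x) ^ n ≈ - (x ^ n)
  -‿^-odd n 2∤n x with odd⇒1+2k n 2∤n
  ... | k , ≡.refl = trans (*-congˡ (even k)) (sym (-‿distribˡ-* x _))
    where
    even : ∀ k → (- x) ^ (k ℕ.* 2) ≈ x ^ (k ℕ.* 2)
    even zero    = refl
    even (suc k) = trans (*-congˡ (*-congˡ (even k)))
      (solve 2 (λ x y → :- x :* (:- x :* y) := x :* (x :* y)) refl x (x ^ (k ℕ.* 2)))

  -- The left side is the literal unfolding, zeros included, of the first entry of xᵗ q x for q = d
  -- times the identity, where the first column of x is (a, -b).
  scalar-form : ∀ a b d → (a * d + - b * 0#) * a + (a * 0# + - b * d) * - b ≈ d * (a ^ 2 + b ^ 2)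
  scalar-form = solve 3 (λ a b d →
    (a :* d :+ (:- b) :* con (+ 0)) :* a :+ (a :* con (+ 0) :+ (:- b) :* d) :* (:- b) :=
    d :* (a :^ 2 :+ b :^ 2)) refl

  x+y-x≈y : ∀ x y → x + y - x ≈ y
  x+y-x≈y = solve 2 (λ x y → x :+ y :- x := y) refl

  -- Here s and t are the δ of one column of x, m and n the p-th powers of another, and e is φ(d).
  -- The factor p turns s and t into the increments s′ and t′.
  multiple-of-Γ : ∀ p {e s s′ t t′ m n} → p • s ≈ s′ → p • t ≈ t′ →
    p • ((s * e + t * 0#) * m + (s * 0# + t * e) * n) ≈ e * (s′ * m + t′ * n)
  multiple-of-Γ p {e} {s} {s′} {t} {t′} {m} {n} ps≈s′ pt≈t′ = begin
    p • ((s * e + t * 0#) * m + (s * 0# + t * e) * n)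
      ≈⟨ as-product _ ⟩
    (p • 1#) * ((s * e + t * 0#) * m + (s * 0# + t * e) * n)
      ≈⟨ solve 6 (λ P e s t m n →
           P :* ((s :* e :+ t :* con (+ 0)) :* m :+ (s :* con (+ 0) :+ t :* e) :* n) :=
           e :* (P :* s :* m :+ P :* t :* n)) refl (p • 1#) e s t m n ⟩
    e * ((p • 1#) * s * m + (p • 1#) * t * n)
      ≈⟨ *-congˡ (+-cong (*-congʳ (trans (sym (as-product s)) ps≈s′))
                         (*-congʳ (trans (sym (as-product t)) pt≈t′))) ⟩
    e * (s′ * m + t′ * n)  ∎
    where
    as-product : ∀ y → p • y ≈ (p • 1#) * y
    as-product y = sym (trans (×-assoc-* p 1# y) (×-congʳ p (*-identityˡ y)))

module PDerivationProperties {c ℓ} (p : ℕ) (A : CommutativeRing c ℓ) (D : PDerivation p A) where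
  open CommutativeRing A
  open CommutativeRingTheory A renaming (_×_ to _•_)
  open PDerivation D using (δ)

  lift : A ⟶ A
  lift = FrobeniusLift.endomorphism (attachedLift p A D)

  pδ : ∀ y → p • δ y ≈ ⟦ lift ⟧ y - y ^ p
  pδ y = sym (x+y-x≈y A (y ^ p) (p • δ y))

  lift≡^p : ∀ y → ⟦ lift ⟧ y ≡ y ^ p [mod p ]
  lift≡^p y = δ y , refl

module _ {c ℓ s ℓs} (p : ℕ) (O : CommutativeRing c ℓ) (S : CommutativeRing s ℓs) (ι : O ⟶ S)
         (φO : O ⟶ O) (D : PDerivation p S) where
  private
    module O = CommutativeRing O
    module S = CommutativeRing S
    module TO = CommutativeRingTheory O
    open Mult S.semiring using (×-congʳ)
    open PDerivationProperties p S D using (lift)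

  lift-extends : (δO : O.Carrier → O.Carrier) →
    (∀ a → ⟦ φO ⟧ a O.≈ a TO.^ p O.+ p TO.× δO a) →
    (∀ a → PDerivation.δ D (⟦ ι ⟧ a) S.≈ ⟦ ι ⟧ (δO a)) →
    ∀ a → ⟦ lift ⟧ (⟦ ι ⟧ a) S.≈ ⟦ ι ⟧ (⟦ φO ⟧ a)
  lift-extends δO φ≈ extends a = S.trans
    (S.+-cong (S.sym (hom-^ O S ι a p)) (S.trans (×-congʳ p (extends a)) (S.sym (hom-× O S ι p _))))
    (S.trans (S.sym (RingHomomorphism.+-homo ι _ _))
             (RingHomomorphism.⟦⟧-cong ι (O.sym (φ≈ a))))

-- Restricting the metric condition and Γ along S ⟶ R

module Restriction {c ℓ s ℓs r ℓr} (p : ℕ)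
  (O : CommutativeRing c ℓ) (S : CommutativeRing s ℓs) (R : CommutativeRing r ℓr)
  (ιS : O ⟶ S) (ιR : O ⟶ R) (restrict : S ⟶ R)
  (restrict-ι : ∀ a → CommutativeRing._≈_ R (⟦ restrict ⟧ (⟦ ιS ⟧ a)) (⟦ ιR ⟧ a))
  (x : Matrices.Matrix S) (α β : CommutativeRing.Carrier R)
  (restrict-x : ∀ i j → CommutativeRing._≈_ R (⟦ restrict ⟧ (x i j))
    (Matrices.matrix R α β (CommutativeRing.-_ R β) α i j))
  (φO : O ⟶ O) (D : PDerivation p S) (D′ : PDerivation p R)
  (induced : ∀ f → CommutativeRing._≈_ R (PDerivation.δ D′ (⟦ restrict ⟧ f)) (⟦ restrict ⟧ (PDerivation.δ D f)))
  (d : CommutativeRing.Carrier O) (Q : Matrices.Matrix O)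
  (Q≈d : Matrices._≈ᴹ_ O Q (Matrices.matrix O d (CommutativeRing.0# O) (CommutativeRing.0# O) d))
  where
  open CommutativeRing R
  open CommutativeRingTheory R renaming (_×_ to _•_)
  open CommutativeExp commutativeSemiring using (^-congˡ)
  open Mult semiring using (×-congʳ)
  open Matrices R using (matrix)
  open PDerivation D′ using () renaming (δ to δ′)
  open PDerivation D using (δ)
  open PDerivationProperties p S D using () renaming (lift to φS)
  open PDerivationProperties p R D′ using () renaming (lift to φ′; pδ to pδ′)
  open SetoidReasoning setoid
  private
    module O = CommutativeRing O
    module TO = CommutativeRingTheory O
    module S = CommutativeRing S
    module TS = CommutativeRingTheory S
    module MO = Matrices O
    module MS = Matrices S
    module r = RingHomomorphism restrict
    module φ′ = RingHomomorphism φ′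
    module ι′ = RingHomomorphism ιR

    res : S.Carrier → Carrier
    res = ⟦ restrict ⟧

    M : Matrices.Matrix R
    M = matrix α β (- β) α

    e : Carrier
    e = ⟦ ιR ⟧ (⟦ φO ⟧ d)

  restrict-lift : ∀ f → res (⟦ φS ⟧ f) ≈ ⟦ φ′ ⟧ (res f)
  restrict-lift f = begin
    res (f TS.^ p S.+ p TS.× δ f)         ≈⟨ r.+-homo _ _ ⟩
    res (f TS.^ p) + res (p TS.× δ f)     ≈⟨ +-cong (hom-^ S R restrict f p) (hom-× S R restrict p _) ⟩
    res f ^ p + p • res (δ f)             ≈⟨ +-congˡ (×-congʳ p (induced f)) ⟨
    res f ^ p + p • δ′ (res f)            ∎

  lift′-extends : (∀ a → ⟦ φS ⟧ (⟦ ιS ⟧ a) S.≈ ⟦ ιS ⟧ (⟦ φO ⟧ a)) →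
                  ∀ a → ⟦ φ′ ⟧ (⟦ ιR ⟧ a) ≈ ⟦ ιR ⟧ (⟦ φO ⟧ a)
  lift′-extends extends a = begin
    ⟦ φ′ ⟧ (⟦ ιR ⟧ a)        ≈⟨ φ′.⟦⟧-cong (restrict-ι a) ⟨
    ⟦ φ′ ⟧ (res (⟦ ιS ⟧ a))  ≈⟨ restrict-lift (⟦ ιS ⟧ a) ⟨
    res (⟦ φS ⟧ (⟦ ιS ⟧ a))  ≈⟨ r.⟦⟧-cong (extends a) ⟩
    res (⟦ ιS ⟧ (⟦ φO ⟧ a))  ≈⟨ restrict-ι (⟦ φO ⟧ a) ⟩
    ⟦ ιR ⟧ (⟦ φO ⟧ a)        ∎

  restrict-form : res ((x MS.ᵗ MS.· mapMatrix O S ιS Q MS.· x) 0F 0F) ≈ ⟦ ιR ⟧ d * (α ^ 2 + β ^ 2)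
  restrict-form = trans expanded (scalar-form R α β (⟦ ιR ⟧ d))
    where
    row : ∀ y z → res (x 0F 0F S.* ⟦ ιS ⟧ y S.+ x 1F 0F S.* ⟦ ιS ⟧ z) ≈ α * ⟦ ιR ⟧ y + - β * ⟦ ιR ⟧ z
    row y z = trans (r.+-homo _ _) (+-cong
      (trans (r.*-homo _ _) (*-cong (restrict-x 0F 0F) (restrict-ι y)))
      (trans (r.*-homo _ _) (*-cong (restrict-x 1F 0F) (restrict-ι z))))

    ιQ≈ : ∀ i j → ⟦ ιR ⟧ (Q i j) ≈ matrix (⟦ ιR ⟧ d) 0# 0# (⟦ ιR ⟧ d) i j
    ιQ≈ 0F 0F = ι′.⟦⟧-cong (Q≈d 0F 0F)
    ιQ≈ 0F 1F = trans (ι′.⟦⟧-cong (Q≈d 0F 1F)) ι′.0#-homo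
    ιQ≈ 1F 0F = trans (ι′.⟦⟧-cong (Q≈d 1F 0F)) ι′.0#-homo
    ιQ≈ 1F 1F = ι′.⟦⟧-cong (Q≈d 1F 1F)

    expanded : res ((x MS.ᵗ MS.· mapMatrix O S ιS Q MS.· x) 0F 0F) ≈
      (α * ⟦ ιR ⟧ d + - β * 0#) * α + (α * 0# + - β * ⟦ ιR ⟧ d) * - β
    expanded = trans (r.+-homo _ _) (+-cong
      (trans (r.*-homo _ _) (*-cong (trans (row _ _) (+-cong (*-congˡ (ιQ≈ 0F 0F)) (*-congˡ (ιQ≈ 1F 0F)))) (restrict-x 0F 0F)))
      (trans (r.*-homo _ _) (*-cong (trans (row _ _) (+-cong (*-congˡ (ιQ≈ 0F 1F)) (*-congˡ (ιQ≈ 1F 1F)))) (restrict-x 1F 0F))))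

  module _ (extends : ∀ a → ⟦ φS ⟧ (⟦ ιS ⟧ a) S.≈ ⟦ ιS ⟧ (⟦ φO ⟧ a))
           (𝓗 φ₀ : S ⟶ S)
           (𝓗-x : ⟦ 𝓗 ⟧ (x 0F 0F) S.≈ (x MS.ᵗ MS.· mapMatrix O S ιS Q MS.· x) 0F 0F)
           (φ₀-x : ⟦ φ₀ ⟧ (x 0F 0F) S.≈ x 0F 0F TS.^ p)
           (metric : ∀ f → ⟦ φS ⟧ (⟦ 𝓗 ⟧ f) S.≈ ⟦ 𝓗 ⟧ (⟦ φ₀ ⟧ f)) where

    -- The metric condition is evaluated at the first entry of x, whose image under `𝓗` restricts to
    -- d(α² + β²). As `φ₀` raises that entry to the p-th power, one side is the p-th power of this
    -- element and the other its image under `φ′`.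
    restricted-metric : ⟦ ιR ⟧ (d TO.^ p) * (α ^ 2 + β ^ 2) ^ p ≈ e * (⟦ φ′ ⟧ α * ⟦ φ′ ⟧ α + ⟦ φ′ ⟧ β * ⟦ φ′ ⟧ β)
    restricted-metric = begin
      ⟦ ιR ⟧ (d TO.^ p) * (α ^ 2 + β ^ 2) ^ p  ≈⟨ *-congʳ (hom-^ O R ιR d p) ⟩
      ⟦ ιR ⟧ d ^ p * (α ^ 2 + β ^ 2) ^ p       ≈⟨ ^-distrib-* _ _ p ⟨
      (⟦ ιR ⟧ d * (α ^ 2 + β ^ 2)) ^ p         ≈⟨ ^-congˡ p restrict-𝓗x ⟨
      res (⟦ 𝓗 ⟧ (x 0F 0F)) ^ p                ≈⟨ hom-^ S R restrict _ p ⟨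
      res (⟦ 𝓗 ⟧ (x 0F 0F) TS.^ p)             ≈⟨ r.⟦⟧-cong (hom-^ S S 𝓗 (x 0F 0F) p) ⟨
      res (⟦ 𝓗 ⟧ (x 0F 0F TS.^ p))             ≈⟨ r.⟦⟧-cong (RingHomomorphism.⟦⟧-cong 𝓗 φ₀-x) ⟨
      res (⟦ 𝓗 ⟧ (⟦ φ₀ ⟧ (x 0F 0F)))           ≈⟨ r.⟦⟧-cong (metric (x 0F 0F)) ⟨
      res (⟦ φS ⟧ (⟦ 𝓗 ⟧ (x 0F 0F)))           ≈⟨ restrict-lift _ ⟩
      ⟦ φ′ ⟧ (res (⟦ 𝓗 ⟧ (x 0F 0F)))           ≈⟨ φ′.⟦⟧-cong restrict-𝓗x ⟩
      ⟦ φ′ ⟧ (⟦ ιR ⟧ d * (α ^ 2 + β ^ 2))      ≈⟨ φ′.*-homo _ _ ⟩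
      ⟦ φ′ ⟧ (⟦ ιR ⟧ d) * ⟦ φ′ ⟧ (α ^ 2 + β ^ 2)
        ≈⟨ *-cong (lift′-extends extends d) (trans (φ′.+-homo _ _) (+-cong (square α) (square β))) ⟩
      e * (⟦ φ′ ⟧ α * ⟦ φ′ ⟧ α + ⟦ φ′ ⟧ β * ⟦ φ′ ⟧ β)  ∎
      where
      open CommutativeExp commutativeSemiring using (^-distrib-*)
      restrict-𝓗x : res (⟦ 𝓗 ⟧ (x 0F 0F)) ≈ ⟦ ιR ⟧ d * (α ^ 2 + β ^ 2)
      restrict-𝓗x = trans (r.⟦⟧-cong 𝓗-x) restrict-form
      square : ∀ y → ⟦ φ′ ⟧ (y ^ 2) ≈ ⟦ φ′ ⟧ y * ⟦ φ′ ⟧ y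
      square y = trans (φ′.⟦⟧-cong (*-congˡ (*-identityʳ y))) (φ′.*-homo y y)

  ΓS : MS.Matrix
  ΓS = (λ i j → δ (x i j)) MS.ᵗ MS.· mapMatrix O S (compose O O S ιS φO) Q MS.· (x MS.^⟨ p ⟩)

  restricted-Γ : ∀ j k → p • res (ΓS j k) ≈
    e * ((⟦ φ′ ⟧ (M 0F j) - M 0F j ^ p) * M 0F k ^ p + (⟦ φ′ ⟧ (M 1F j) - M 1F j ^ p) * M 1F k ^ p)
  restricted-Γ j k = trans (×-congʳ p expanded)
    (multiple-of-Γ R p (pδ′ (M 0F j)) (pδ′ (M 1F j)))
    where
    m δM : Fin 2 → Carrier
    m l = M l k ^ p
    δM l = δ′ (M l j)

    φQ : Matrices.Matrix R
    φQ = mapMatrix O R (compose O O R ιR φO) Q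

    φQ≈ : ∀ i j → φQ i j ≈ matrix e 0# 0# e i j
    φQ≈ i j = trans (ι′.⟦⟧-cong (RingHomomorphism.⟦⟧-cong φO (Q≈d i j))) (φdiag≈ i j)
      where
      φ0≈0 : ⟦ ιR ⟧ (⟦ φO ⟧ O.0#) ≈ 0#
      φ0≈0 = trans (ι′.⟦⟧-cong (RingHomomorphism.0#-homo φO)) ι′.0#-homo
      φdiag≈ : ∀ i j → ⟦ ιR ⟧ (⟦ φO ⟧ (MO.matrix d O.0# O.0# d i j)) ≈ matrix e 0# 0# e i j
      φdiag≈ 0F 0F = refl
      φdiag≈ 0F 1F = φ0≈0
      φdiag≈ 1F 0F = φ0≈0
      φdiag≈ 1F 1F = refl

    restrict-δx : ∀ l → res (δ (x l j)) ≈ δM l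
    restrict-δx l = trans (sym (induced (x l j))) (PDerivation.δ-cong D′ (restrict-x l j))

    restrict-xᵖ : ∀ l → res (x l k TS.^ p) ≈ m l
    restrict-xᵖ l = trans (hom-^ S R restrict (x l k) p) (^-congˡ p (restrict-x l k))

    row : ∀ y z → res (δ (x 0F j) S.* ⟦ ιS ⟧ y S.+ δ (x 1F j) S.* ⟦ ιS ⟧ z)
      ≈ δM 0F * ⟦ ιR ⟧ y + δM 1F * ⟦ ιR ⟧ z
    row y z = trans (r.+-homo _ _) (+-cong
      (trans (r.*-homo _ _) (*-cong (restrict-δx 0F) (restrict-ι y)))
      (trans (r.*-homo _ _) (*-cong (restrict-δx 1F) (restrict-ι z))))

    expanded : res (ΓS j k) ≈ (δM 0F * e + δM 1F * 0#) * m 0F + (δM 0F * 0# + δM 1F * e) * m 1F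
    expanded = trans (r.+-homo _ _) (+-cong
      (trans (r.*-homo _ _) (*-cong (trans (row _ _) (+-cong (*-congˡ (φQ≈ 0F 0F)) (*-congˡ (φQ≈ 1F 0F)))) (restrict-xᵖ 0F)))
      (trans (r.*-homo _ _) (*-cong (trans (row _ _) (+-cong (*-congˡ (φQ≈ 0F 1F)) (*-congˡ (φQ≈ 1F 1F)))) (restrict-xᵖ 1F))))

  module _ (p-odd : ¬ 2 ∣ p) where
    open LiftIncrement R p α β φ′
    open RingProperties ring using (-‿distribʳ-*)
    private
      a = α ^ p
      b = β ^ p
      A = ⟦ φ′ ⟧ α
      B = ⟦ φ′ ⟧ β
      [-β]ᵖ≈-b : (- β) ^ p ≈ - b
      [-β]ᵖ≈-b = -‿^-odd R p p-odd β
      increment[-β] : ⟦ φ′ ⟧ (- β) - (- β) ^ p ≈ - B - - b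
      increment[-β] = +-cong (φ′.-‿homo β) (-‿cong [-β]ᵖ≈-b)
      open IntegerSolver R

    -- The columns of x restrict to (α, -β) and (β, α). Pairing increments of column j with p-th
    -- powers of column k gives the real part when j = k, and the imaginary part up to sign
    -- otherwise.
    restricted-Γ₀₀ : p • res (ΓS 0F 0F) ≈ e * real
    restricted-Γ₀₀ = trans (restricted-Γ 0F 0F) (*-congˡ (trans
      (+-congˡ (*-cong increment[-β] [-β]ᵖ≈-b))
      (solve 4 (λ a b A B → (A :- a) :* a :+ (:- B :- (:- b)) :* (:- b) :=
                            (A :- a) :* a :+ (B :- b) :* b) refl a b A B)))

    restricted-Γ₀₁ : p • res (ΓS 0F 1F) ≈ - (e * imaginary)
    restricted-Γ₀₁ = trans (restricted-Γ 0F 1F) (trans (*-congˡ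
      (+-congˡ (*-congʳ increment[-β])))
      (solve 5 (λ e a b A B → e :* ((A :- a) :* b :+ (:- B :- (:- b)) :* a) :=
                              :- (e :* ((B :- b) :* a :- (A :- a) :* b))) refl e a b A B))

    restricted-Γ₁₀ : p • res (ΓS 1F 0F) ≈ e * imaginary
    restricted-Γ₁₀ = trans (restricted-Γ 1F 0F) (*-congˡ (+-congˡ
      (trans (*-congˡ [-β]ᵖ≈-b) (sym (-‿distribʳ-* (A - a) b)))))

    restricted-Γ₁₁ : p • res (ΓS 1F 1F) ≈ e * real
    restricted-Γ₁₁ = trans (restricted-Γ 1F 1F) (*-congˡ (+-comm _ _))

module _ {a ℓa b ℓb} (A : CommutativeRing a ℓa) (B : CommutativeRing b ℓb) (f : A ⟶ B) where
  private
    module B = CommutativeRing B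
    module f = RingHomomorphism f
    open CommutativeRing A
    open CommutativeRingTheory A

  hom-quotient : ∀ (x y : Unit) → ⟦ f ⟧ (value (x *ᵘ inverse y)) B.* ⟦ f ⟧ (value y) B.≈ ⟦ f ⟧ (value x)
  hom-quotient x y = B.trans (B.sym (f.*-homo _ _)) (f.⟦⟧-cong
    (trans (*-assoc _ _ _) (trans (*-congˡ (proj₁ (proj₂ (isUnit y)))) (*-identityʳ _))))

-- Specialisation to the completed coordinate rings

module RestrictedLeviCivita
  {c ℓ} (p : ℕ) (p-prime : Prime p) (p-odd : ¬ 2 ∣ p) (O : CommutativeRing c ℓ) (O-dvr : IsCompleteDVR O p)
  (φ : FrobeniusLift p O)
  (q : Fin 2 → Matrices.SymmetricGL₂ O) (d : Fin 2 → CommutativeRing.Carrier O)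
  (q≈d : ∀ i → Matrices._≈ᴹ_ O (Matrices.SymmetricGL₂.entries (q i))
    (Matrices.matrix O (d i) (CommutativeRing.0# O) (CommutativeRing.0# O) (d i)))
  where
  open LeviCivita p p-prime O O-dvr φ

  module _
    (connection : Fin 2 → Connection) (isLeviCivita : IsLeviCivita q connection)
    (D′ : Fin 2 → PDerivation p O[Ĝ′])
    (induced : ∀ i f → CommutativeRing._≈_ O[Ĝ′]
      (PDerivation.δ (D′ i) (⟦ restriction ⟧ f)) (⟦ restriction ⟧ (Connection.δ (connection i) f)))
    where
    open CommutativeRing O[Ĝ′]
    open CommutativeRingTheory O[Ĝ′] using (_^_)
    open Mult semiring using (×-congʳ)
    open LiftIncrement O[Ĝ′] p α̂ β̂
    open IsLeviCivita isLeviCivita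

    private
      φO = FrobeniusLift.endomorphism φ

      φ′ : Fin 2 → O[Ĝ′] ⟶ O[Ĝ′]
      φ′ i = PDerivationProperties.lift p O[Ĝ′] (D′ i)

      e : Fin 2 → Carrier
      e i = ⟦ ιG′ ⟧ (⟦ φO ⟧ (d i))

      module Restricted (i : Fin 2) = Restriction p O O[Ĝ] O[Ĝ′] ιG ιG′ restriction
        -- A continuous extension applied to a constant sequence has the prescribed value
        -- componentwise, so both sides have the same representatives.
        (λ a → pointwise p O[G′] λ _ → PresentationG′.∼-refl)
        x α̂ β̂ (λ j k → pointwise p O[G′] λ _ → PresentationG′.∼-refl)
        φO (Connection.derivation (connection i)) (D′ i) (induced i) (d i) (Matrices.SymmetricGL₂.entries (q i)) (q≈d i)

    restricted-metric : ∀ i → ⟦ ιG′ ⟧ (CommutativeRingTheory._^_ O (d i) p) * (α̂ ^ 2 + β̂ ^ 2) ^ p ≈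
      e i * (⟦ φ′ i ⟧ α̂ * ⟦ φ′ i ⟧ α̂ + ⟦ φ′ i ⟧ β̂ * ⟦ φ′ i ⟧ β̂)
    restricted-metric i = Restricted.restricted-metric i
      (lift-extends p O O[Ĝ] ιG φO (Connection.derivation (connection i)) (PDerivation.δ δO)
        (λ a → Congruent.equation (FrobeniusLift.lifts φ a)) (Connection.extends (connection i)))
      (𝓗 (q i)) (φ₀ φ)
      (pointwise p O[G] λ _ → PresentationG.∼-refl)
      (pointwise p O[G] λ _ → PresentationG.∼-refl)
      (metric i)

    -- The symmetry of Γ has content only when its first two indices differ; the third index being 1
    -- or 2 gives this relation and the next.
    restricted-symmetry₀ : e 0F * imaginary (φ′ 0F) ≈ e 1F * real (φ′ 1F)
    restricted-symmetry₀ = trans (sym (Restricted.restricted-Γ₁₀ 0F p-odd))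
      (trans (×-congʳ p (RingHomomorphism.⟦⟧-cong restriction (symmetric 0F 1F 0F)))
             (Restricted.restricted-Γ₀₀ 1F p-odd))

    restricted-symmetry₁ : e 0F * real (φ′ 0F) ≈ - (e 1F * imaginary (φ′ 1F))
    restricted-symmetry₁ = trans (sym (Restricted.restricted-Γ₁₁ 0F p-odd))
      (trans (×-congʳ p (RingHomomorphism.⟦⟧-cong restriction (symmetric 0F 1F 1F)))
             (Restricted.restricted-Γ₀₁ 1F p-odd))

proposition2p23 :
  {c ℓ : Level} (p : ℕ) (p-prime : Prime p) (p-odd : ¬ 2 ∣ p)
  (O : CommutativeRing c ℓ) (O-dvr : IsCompleteDVR O p) (O-perfect : PerfectModulo O p)
  (φ : FrobeniusLift p O) (d : Fin 2 → CommutativeRingTheory.Unit O) →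
  let open LeviCivita p p-prime O O-dvr φ in
  (D′ : Fin 2 → PDerivation p O[Ĝ′]) → IsLeviCivita′ d D′ →
  let open CommutativeRing O[Ĝ′]
      open CommutativeRingTheory O[Ĝ′] renaming (_×_ to _•_)
      open Matrices O[Ĝ′]
      module TO = CommutativeRingTheory O

      φO = FrobeniusLift.endomorphism φ

      φ′ : Fin 2 → O[Ĝ′] ⟶ O[Ĝ′]
      φ′ i = FrobeniusLift.endomorphism (attachedLift p O[Ĝ′] (D′ i))

      εᵘ : Unit
      εᵘ = mapUnit O O[Ĝ′] ιG′ (mapUnit O O φO (d 1F TO.*ᵘ TO.inverse (d 0F)))

      θᵘ : Fin 2 → Unit
      θᵘ i = (mapUnit O O[Ĝ′] ιG′ (d i TO.^ᵘ p) *ᵘ norm-unit ^ᵘ p)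
               *ᵘ inverse (mapUnit O O[Ĝ′] ιG′ (mapUnit O O φO (d i)) *ᵘ frobenius-norm-unit)

      ε : Carrier
      ε = value εᵘ

      ε⁻¹ : Carrier
      ε⁻¹ = value (inverse εᵘ)

      θ : Fin 2 → Carrier
      θ i = value (θᵘ i)

      IsSolution : Carrier → Carrier → Set (c ⊔ ℓ)
      IsSolution x₁ x₂ =
        x₁ ≡ 0# [mod p ] ×
        x₂ ≡ 0# [mod p ] ×
        (x₁ ^ 2 - 2 • (ε * x₂) + ε ^ 2 * x₂ ^ 2 ≈ θ 0F - 1#) ×
        (x₁ ^ 2 + 2 • (ε * x₁) + ε ^ 2 * x₂ ^ 2 ≈ ε ^ 2 * (θ 1F - 1#))
  in
  ∃ λ v₁ → ∃ λ v₂ →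
    IsSolution v₁ v₂ ×
    (∀ w₁ w₂ → IsSolution w₁ w₂ → (w₁ ≈ v₁) × (w₂ ≈ v₂)) ×
    (let u₂ = 1# + ε⁻¹ * v₁
         u₁ = 1# - ε * v₂
     in
     (mapMatrix O[Ĝ′] O[Ĝ′] (φ′ 0F) (matrix α̂ β̂ (- β̂) α̂)
        ≈ᴹ matrix (α̂ ^ p) (β̂ ^ p) (- (β̂ ^ p)) (α̂ ^ p) · matrix u₁ v₁ (- v₁) u₁) ×
     (mapMatrix O[Ĝ′] O[Ĝ′] (φ′ 1F) (matrix α̂ β̂ (- β̂) α̂)
        ≈ᴹ matrix (α̂ ^ p) (β̂ ^ p) (- (β̂ ^ p)) (α̂ ^ p) · matrix u₂ v₂ (- v₂) u₂))
proposition2p23 p p-prime p-odd O O-dvr O-perfect φ d D′ LC =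
  QuadraticSystem.unique-solution-and-lifts O[Ĝ′] p (unit-mod-p p O[G′]) p-odd
    α̂ β̂ frobenius-norm-unit (CommutativeRing.refl O[Ĝ′])
    (λ i → PDerivationProperties.lift p O[Ĝ′] (D′ i))
    (λ i → PDerivationProperties.lift≡^p p O[Ĝ′] (D′ i))
    (λ i → mapUnit O O[Ĝ′] ιG′ (mapUnit O O φO (d i)))
    (mapUnit O O[Ĝ′] ιG′ (mapUnit O O φO (d 1F TO.*ᵘ TO.inverse (d 0F))))
    (hom-quotient O O[Ĝ′] (compose O O O[Ĝ′] ιG′ φO) (d 1F) (d 0F))
    -- The numerators of the θᵢ, determined by the left side of `restricted-metric`.
    _
    (restricted-metric connection isLeviCivita D′ induced)
    (restricted-symmetry₀ connection isLeviCivita D′ induced)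
    (restricted-symmetry₁ connection isLeviCivita D′ induced)
  where
  open LeviCivita p p-prime O O-dvr φ
  open IsLeviCivita′ LC
  module TO = CommutativeRingTheory O
  φO = FrobeniusLift.endomorphism φ
  open RestrictedLeviCivita p p-prime p-odd O O-dvr φ
    (λ i → Matrices.scalar O (d i)) (λ i → TO.value (d i)) (λ i j k → CommutativeRing.refl O)
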